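{- Let $\mathcal{B}$ be a locally finite thick affine building of type $\tilde A_2$ of order $q$, and let $\Gamma$ be a group of type rotating automorphisms of $\mathcal{B}$ acting freely and with finitely many orbits on the vertices of $\mathcal{B}$. Let $A$ be the finite alphabet of $\Gamma$-orbits of tiles and $W=\bigcup_m W_m$ the set of words, with maps $o,t:W\to A$ and shape $\sigma(u)\in\mathbb{Z}_{\geq 0}^2$ of $u\in W$. Then every choice of nonnegative real numbers $\{\tilde g(v)\in\mathbb{R}_+ : v\in A\}$ determines a function $\tilde g:W\to\mathbb{R}_+$ given by $$\tilde g(u)=q^{ -2(m_1+m_2)}\,\tilde g(o(u)),\qquad (m_1,m_2)=\sigma(u),$$ which satisfies, for both $i=1$ and $i=2$ and for all $u\in W$, $$\tilde g(u)=\sum_{\substack{w\in W,\ \sigma(w)=e_i,\\ o(w)=t(u)}}\tilde g(uw).$$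
   Context: The building $\mathcal{B}$ is of order $q$: every edge of $\mathcal{B}$ lies in exactly $q+1$ chambers (triangles). Vertices have types in $\mathbb{Z}/3$; an automorphism or isometry is type rotating if it changes all types by a fixed cyclic shift $i\mapsto i+c$. Model apartment: take a Coxeter complex of type $\tilde A_2$ (the Euclidean plane tessellated by equilateral triangles), fix a vertex of type $0$ as origin, and coordinatize its vertices by $\mathbb{Z}^2$ using as axes two of the three walls through the origin, so that the nonnegative quadrant is a $\pi/3$-angled sector. For $m=(m_1,m_2)\in\mathbb{Z}_{\geq0}^2$, let $\mathfrak{p}_m$ be the parallelogram based at $(0,0)$ spanned by $(m_1+1,0)$ and $(0,m_2+1)$, and let $\mathfrak{t}=\mathfrak{p}_{(0,0)}$ be the model tile (two triangles). Let $\mathfrak{B}_m$ be the set of type rotating isometries $\mathfrak{p}_m\to\mathcal{B}$. Words of shape $m$ are the $\Gamma$-orbits: $W_m=\Gamma\backslash\mathfrak{B}_m$, $W=\bigcup_m W_m$, $A=W_{(0,0)}$, and $\sigma(u)=m$ for $u\in W_m$. For $p\in\mathfrak{B}_m$ the initial tile is $o(p)=p|_{\mathfrak{t}}$ and the terminal tile is $t(p)(l)=p(m+l)$, $l\in\mathfrak{t}$; these induce $o,t:W\to A$. Let $e_1=(1,0)$, $e_2=(0,1)$. For $u\in W_m$ and $w\in W_{e_i}$ with $o(w)=t(u)$, the product $uw\in W_{m+e_i}$ is the unique class having a representative $p'\in\mathfrak{B}_{m+e_i}$ such that $p'|_{\mathfrak{p}_m}$ represents $u$ and $l\mapsto p'(m+l)$,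 $l\in\mathfrak{p}_{e_i}$, represents $w$ (this exists and is unique). -}

module Defs where

open import Algebra.Bundles using (Group)
open import Data.Fin.Base using (Fin; zero; suc; toℕ)
open import Data.Integer.Base as ℤ using (ℤ; +_)
open import Data.Integer.Divisibility using (_∣_)
import Data.Integer.Properties as ℤ
open import Data.Integer.Tactic.RingSolver using (solve-∀)
open import Data.List.Base using (List; []; _∷_; map)
open import Data.List.Membership.Propositional using (_∈_)
open import Data.List.Relation.Binary.Subset.Propositional using (_⊆_)
open import Data.Nat.Base as ℕ using (ℕ; suc; _⊔_)
import Data.Nat.Properties as ℕ
open import Data.Product.Base
  using (Σ-syntax; ∃; ∃-syntax; ∃₂; _×_; _,_; proj₁; proj₂)
open import Data.Rational.Base as ℚ using (ℚ; 0ℚ; 1ℚ; ½; ∣_∣)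
import Data.Rational.Properties as ℚ
open import Data.Rational.Solver using (module +-*-Solver)
import Data.Vec.Functional as Vector
open import Function.Base using (_∘_)
open import Function.Bundles using (Bijection; Func; Inverse; _↔_; _⇔_)
open import Function.Definitions using (Injective)
open import Level using (0ℓ)
open import Relation.Binary.Bundles using (Setoid)
import Relation.Binary.Construct.On as On
open import Relation.Binary.PropositionalEquality
  using (_≡_; _≢_; refl; sym; trans; cong; cong₂; subst; setoid)

------------------------------------------------------------------------
-- Real numbers: Cauchy sequences of rationals.  The modulus of convergence
-- is carried as data.

record ℝ : Set where
  field
    seq    : ℕ → ℚ
    cauchy : ∀ ε → 0ℚ ℚ.< ε →
             ∃[ N ] ∀ m n → N ℕ.≤ m → N ℕ.≤ n → ∣ seq m ℚ.- seq n ∣ ℚ.≤ ε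
open ℝ public

infix 4 _≃_

_≃_ : ℝ → ℝ → Set
x ≃ y = ∀ ε → 0ℚ ℚ.< ε →
        ∃[ N ] ∀ n → N ℕ.≤ n → ∣ seq x n ℚ.- seq y n ∣ ℚ.≤ ε

NonNegative : ℝ → Set
NonNegative x = ∀ ε → 0ℚ ℚ.< ε → ∃[ N ] ∀ n → N ℕ.≤ n → ℚ.- ε ℚ.≤ seq x n

private
  open +-*-Solver using (solve; _:=_; _:+_; _:-_; _:*_; :-_)

  half>0 : ∀ {ε} → 0ℚ ℚ.< ε → 0ℚ ℚ.< ½ ℚ.* ε
  half>0 {ε} p = ℚ.positive⁻¹ (½ ℚ.* ε) {{ℚ.pos*pos⇒pos ½ ε {{ℚ.positive p}}}}

  halves : ∀ ε → ½ ℚ.* ε ℚ.+ ½ ℚ.* ε ≡ ε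
  halves ε = trans (sym (ℚ.*-distribʳ-+ ε ½ ½)) (ℚ.*-identityˡ ε)

  split : ∀ a b {ε} → ∣ a ∣ ℚ.≤ ½ ℚ.* ε → ∣ b ∣ ℚ.≤ ½ ℚ.* ε →
          ∣ a ℚ.+ b ∣ ℚ.≤ ε
  split a b {ε} p r = subst (∣ a ℚ.+ b ∣ ℚ.≤_) (halves ε)
    (ℚ.≤-trans (ℚ.∣p+q∣≤∣p∣+∣q∣ a b) (ℚ.+-mono-≤ p r))

  +-sub : ∀ a b c d → (a ℚ.- c) ℚ.+ (b ℚ.- d) ≡ (a ℚ.+ b) ℚ.- (c ℚ.+ d)
  +-sub = solve 4 (λ a b c d → (a :- c) :+ (b :- d) := (a :+ b) :- (c :+ d)) refl

  mid-sub : ∀ a b c → (a ℚ.- b) ℚ.+ (b ℚ.- c) ≡ a ℚ.- c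
  mid-sub = solve 3 (λ a b c → (a :- b) :+ (b :- c) := a :- c) refl

  flip-sub : ∀ a b → ℚ.- (a ℚ.- b) ≡ b ℚ.- a
  flip-sub = solve 2 (λ a b → :- (a :- b) := b :- a) refl

  *-sub : ∀ r a b → r ℚ.* (a ℚ.- b) ≡ r ℚ.* a ℚ.- r ℚ.* b
  *-sub = solve 3 (λ r a b → r :* (a :- b) := r :* a :- r :* b) refl

  ∣self-sub∣ : ∀ a → ∣ a ℚ.- a ∣ ≡ 0ℚ
  ∣self-sub∣ a = cong ∣_∣ (ℚ.+-inverseʳ a)

  ∣flip∣ : ∀ a b → ∣ a ℚ.- b ∣ ≡ ∣ b ℚ.- a ∣
  ∣flip∣ a b = trans (sym (ℚ.∣-p∣≡∣p∣ (a ℚ.- b))) (cong ∣_∣ (flip-sub a b))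

  -- For r ≥ 0 and ε > 0 there is δ > 0 with r δ ≤ ε, namely δ = ε / (1 + r).
  shrink : ∀ r .{{_ : ℚ.NonNegative r}} ε → 0ℚ ℚ.< ε →
           ∃[ δ ] (0ℚ ℚ.< δ × r ℚ.* δ ℚ.≤ ε)
  shrink r ε ε>0 = δ , δ>0 , subst (r ℚ.* δ ℚ.≤_) eq rδ≤
    where
    instance
      s>0 : ℚ.Positive (1ℚ ℚ.+ r)
      s>0 = ℚ.pos+nonNeg⇒pos 1ℚ r
      s≢0 : ℚ.NonZero (1ℚ ℚ.+ r)
      s≢0 = ℚ.pos⇒nonZero (1ℚ ℚ.+ r)
    s⁻¹ = ℚ.1/ (1ℚ ℚ.+ r)
    δ = s⁻¹ ℚ.* ε
    instance
      δ-pos : ℚ.Positive δ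
      δ-pos = ℚ.pos*pos⇒pos s⁻¹ {{ℚ.1/pos⇒pos (1ℚ ℚ.+ r)}} ε {{ℚ.positive ε>0}}
    δ>0 = ℚ.positive⁻¹ δ
    eq : (1ℚ ℚ.+ r) ℚ.* δ ≡ ε
    eq = trans (sym (ℚ.*-assoc (1ℚ ℚ.+ r) s⁻¹ ε))
        (trans (cong (ℚ._* ε) (ℚ.*-inverseʳ (1ℚ ℚ.+ r))) (ℚ.*-identityˡ ε))
    r≤s : r ℚ.≤ 1ℚ ℚ.+ r
    r≤s = subst (ℚ._≤ 1ℚ ℚ.+ r) (ℚ.+-identityˡ r)
            (ℚ.+-monoˡ-≤ r (ℚ.nonNegative⁻¹ 1ℚ))
    rδ≤ : r ℚ.* δ ℚ.≤ (1ℚ ℚ.+ r) ℚ.* δ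
    rδ≤ = ℚ.*-monoʳ-≤-nonNeg δ {{ℚ.pos⇒nonNeg δ}} r≤s

  ∣*∣ : ∀ r .{{_ : ℚ.NonNegative r}} a {δ ε} →
        ∣ a ∣ ℚ.≤ δ → r ℚ.* δ ℚ.≤ ε → ∣ r ℚ.* a ∣ ℚ.≤ ε
  ∣*∣ r a p rδ≤ε = subst (ℚ._≤ _)
    (sym (trans (ℚ.∣p*q∣≡∣p∣*∣q∣ r a)
                (cong (ℚ._* ∣ a ∣) (ℚ.0≤p⇒∣p∣≡p (ℚ.nonNegative⁻¹ r)))))
    (ℚ.≤-trans (ℚ.*-monoˡ-≤-nonNeg r p) rδ≤ε)

record ℝ₊ : Set where
  constructor mkℝ₊
  field
    value  : ℝ
    nonNeg : NonNegative value
open ℝ₊ public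

ℝ₊-setoid : Setoid 0ℓ 0ℓ
ℝ₊-setoid = record
  { Carrier = ℝ₊
  ; _≈_     = λ x y → value x ≃ value y
  ; isEquivalence = record
    { refl  = λ {x} ε ε>0 → 0 , λ n _ →
        subst (ℚ._≤ ε) (sym (∣self-sub∣ (seq (value x) n))) (ℚ.<⇒≤ ε>0)
    ; sym   = λ {x} {y} p ε ε>0 → let N , h = p ε ε>0 in N , λ n N≤n →
        subst (ℚ._≤ ε) (∣flip∣ (seq (value x) n) (seq (value y) n)) (h n N≤n)
    ; trans = λ {x} {y} {z} p r ε ε>0 →
        let N , h = p (½ ℚ.* ε) (half>0 ε>0)
            M , k = r (½ ℚ.* ε) (half>0 ε>0)
            a = seq (value x) ; b = seq (value y) ; c = seq (value z)
        in N ⊔ M , λ n le → subst (λ d → ∣ d ∣ ℚ.≤ ε) (mid-sub (a n) (b n) (c n))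
             (split (a n ℚ.- b n) (b n ℚ.- c n)
                (h n (ℕ.m⊔n≤o⇒m≤o N M le)) (k n (ℕ.m⊔n≤o⇒n≤o N M le)))
    }
  }

0ℝ₊ : ℝ₊
0ℝ₊ = mkℝ₊
  record { seq = λ _ → 0ℚ ; cauchy = λ ε ε>0 → 0 , λ _ _ _ _ → ℚ.<⇒≤ ε>0 }
  λ ε ε>0 → 0 , λ _ _ → ℚ.<⇒≤ (ℚ.neg-antimono-< ε>0)

infixl 6 _+₊_

_+₊_ : ℝ₊ → ℝ₊ → ℝ₊
mkℝ₊ x x≥0 +₊ mkℝ₊ y y≥0 = mkℝ₊ record { seq = s ; cauchy = c } s≥0
  where
  s : ℕ → ℚ
  s n = seq x n ℚ.+ seq y n

  c : ∀ ε → 0ℚ ℚ.< ε → ∃[ N ] ∀ m n → N ℕ.≤ m → N ℕ.≤ n → ∣ s m ℚ.- s n ∣ ℚ.≤ ε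
  c ε ε>0 =
    let N , h = cauchy x (½ ℚ.* ε) (half>0 ε>0)
        M , k = cauchy y (½ ℚ.* ε) (half>0 ε>0)
    in N ⊔ M , λ m n le le′ →
         subst (λ d → ∣ d ∣ ℚ.≤ ε) (+-sub (seq x m) (seq y m) (seq x n) (seq y n))
           (split (seq x m ℚ.- seq x n) (seq y m ℚ.- seq y n)
             (h m n (ℕ.m⊔n≤o⇒m≤o N M le) (ℕ.m⊔n≤o⇒m≤o N M le′))
             (k m n (ℕ.m⊔n≤o⇒n≤o N M le) (ℕ.m⊔n≤o⇒n≤o N M le′)))

  s≥0 : ∀ ε → 0ℚ ℚ.< ε → ∃[ N ] ∀ n → N ℕ.≤ n → ℚ.- ε ℚ.≤ s n
  s≥0 ε ε>0 =
    let N , h = x≥0 (½ ℚ.* ε) (half>0 ε>0)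
        M , k = y≥0 (½ ℚ.* ε) (half>0 ε>0)
    in N ⊔ M , λ n le → subst (ℚ._≤ s n)
         (trans (sym (ℚ.neg-distrib-+ (½ ℚ.* ε) (½ ℚ.* ε))) (cong ℚ.-_ (halves ε)))
         (ℚ.+-mono-≤ (h n (ℕ.m⊔n≤o⇒m≤o N M le)) (k n (ℕ.m⊔n≤o⇒n≤o N M le)))

infixr 7 _·_

_·_ : (r : ℚ) .{{_ : ℚ.NonNegative r}} → ℝ₊ → ℝ₊
r · mkℝ₊ x x≥0 = mkℝ₊ record { seq = s ; cauchy = c } s≥0
  where
  s : ℕ → ℚ
  s n = r ℚ.* seq x n

  c : ∀ ε → 0ℚ ℚ.< ε → ∃[ N ] ∀ m n → N ℕ.≤ m → N ℕ.≤ n → ∣ s m ℚ.- s n ∣ ℚ.≤ ε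
  c ε ε>0 =
    let δ , δ>0 , rδ≤ε = shrink r ε ε>0
        N , h = cauchy x δ δ>0
    in N , λ m n le le′ →
         subst (λ d → ∣ d ∣ ℚ.≤ ε) (*-sub r (seq x m) (seq x n))
           (∣*∣ r (seq x m ℚ.- seq x n) (h m n le le′) rδ≤ε)

  s≥0 : ∀ ε → 0ℚ ℚ.< ε → ∃[ N ] ∀ n → N ℕ.≤ n → ℚ.- ε ℚ.≤ s n
  s≥0 ε ε>0 =
    let δ , δ>0 , rδ≤ε = shrink r ε ε>0
        N , h = x≥0 δ δ>0
    in N , λ n le → ℚ.≤-trans (ℚ.neg-antimono-≤ rδ≤ε)
         (subst (ℚ._≤ s n) (sym (ℚ.neg-distribʳ-* r δ))
           (ℚ.*-monoˡ-≤-nonNeg r (h n le)))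

·-cong : (r : ℚ) .{{_ : ℚ.NonNegative r}} → ∀ {x y} →
         value x ≃ value y → value (r · x) ≃ value (r · y)
·-cong r {mkℝ₊ x _} {mkℝ₊ y _} p ε ε>0 =
  let δ , δ>0 , rδ≤ε = shrink r ε ε>0
      N , h = p δ δ>0
  in N , λ n le → subst (λ d → ∣ d ∣ ℚ.≤ ε) (*-sub r (seq x n) (seq y n))
       (∣*∣ r (seq x n ℚ.- seq y n) (h n le) rδ≤ε)

infix 8 _^-_

_^-_ : (q : ℕ) .{{_ : ℕ.NonZero q}} → ℕ → ℚ
q ^- k = ℚ._/_ (+ 1) (q ℕ.^ k) {{ℕ.m^n≢0 q k}}

^--nonNegative : ∀ q .{{_ : ℕ.NonZero q}} k → ℚ.NonNegative (q ^- k)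
^--nonNegative q k = ℚ.normalize-nonNeg 1 (q ℕ.^ k) {{ℕ.m^n≢0 q k}}

-- total = ∑ f over the (necessarily finite) set S, enumerated without
-- repetition.
IsSum : (S : Setoid 0ℓ 0ℓ) → (Setoid.Carrier S → ℝ₊) → ℝ₊ → Set
IsSum S f total =
  ∃[ n ] Σ[ enum ∈ Bijection (setoid (Fin n)) S ]
    value total ≃ value (Vector.foldr _+₊_ 0ℝ₊ (f ∘ Bijection.to enum))

------------------------------------------------------------------------
-- The model apartment: the vertices of the Coxeter complex of type Ã₂ are
-- ℤ², with coordinate axes two walls at angle π/3.

Pt : Set
Pt = ℤ × ℤ

-- |x₁ e₁ + x₂ e₂|², for unit vectors e₁ and e₂ at angle π/3.
∥_∥² : Pt → ℤ
∥ x₁ , x₂ ∥² = x₁ ℤ.* x₁ ℤ.+ x₁ ℤ.* x₂ ℤ.+ x₂ ℤ.* x₂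

dist² : Pt → Pt → ℤ
dist² (a₁ , a₂) (b₁ , b₂) = ∥ a₁ ℤ.- b₁ , a₂ ℤ.- b₂ ∥²

-- The chambers of the tessellation are the unit equilateral triangles.
Triangle : Pt → Pt → Pt → Set
Triangle a b c = dist² a b ≡ + 1 × dist² b c ≡ + 1 × dist² a c ≡ + 1

infix 4 _≡₃_

_≡₃_ : ℤ → ℤ → Set
x ≡₃ y = + 3 ∣ x ℤ.- y

-- Read modulo 3: the origin has type 0 and the types on each triangle are
-- pairwise distinct.  The only other such labelling is the negative of this
-- one, so choosing it only fixes which nonzero types are called 1 and 2.
type : Pt → ℤ
type (a₁ , a₂) = a₁ ℤ.- a₂

module _ {X : Set} (Chamber : X → X → X → Set) where

  -- A simplex, listed by its vertices, is a set contained in a chamber.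
  IsSimplex : List X → Set
  IsSimplex xs =
    ∃[ x ] ∃₂ λ y z → Chamber x y z × xs ⊆ (x ∷ y ∷ z ∷ [])

record Automorphism : Set where
  field
    bijection  : Pt ↔ Pt
  open Inverse bijection public using (to)
  field
    simplicial : ∀ {a b c} → Triangle a b c ⇔ Triangle (to a) (to b) (to c)

------------------------------------------------------------------------
-- Buildings of type Ã₂, as labelled simplicial complexes with a system of
-- apartments.  Chamber x y z says that {x, y, z} is a chamber.  An apartment
-- is the image of a type-preserving chart from the model apartment.

record Building : Set₁ where
  field
    Vertex  : Set
    Chamber : Vertex → Vertex → Vertex → Set
    τ       : Vertex → Fin 3

    chamber-swap   : ∀ {x y z} → Chamber x y z → Chamber y x z
    chamber-rotate : ∀ {x y z} → Chamber x y z → Chamber y z x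
    chamber-types  : ∀ {x y z} → Chamber x y z → τ x ≢ τ y
    chamber-cover  : ∀ x → ∃₂ λ y z → Chamber x y z

    Apartment       : Set
    chart           : Apartment → Pt → Vertex
    chart-injective : ∀ α → Injective _≡_ _≡_ (chart α)
    chart-chamber   : ∀ α {a b c} → Triangle a b c →
                      Chamber (chart α a) (chart α b) (chart α c)
    chart-type      : ∀ α a → + toℕ (τ (chart α a)) ≡₃ type a

    -- Any two simplices lie in a common apartment.
    common-apartment :
      ∀ {xs ys} → IsSimplex Chamber xs → IsSimplex Chamber ys →
      ∃[ α ] ∃₂ λ as bs → (IsSimplex Triangle as × map (chart α) as ≡ xs)
                        × (IsSimplex Triangle bs × map (chart α) bs ≡ ys)

    -- Two apartments sharing two simplices are isomorphic by an isomorphism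
    -- fixing both simplices pointwise; θ is that isomorphism read in charts.
    apartment-iso :
      ∀ α β {as bs as′ bs′} →
      IsSimplex Triangle as → IsSimplex Triangle as′ →
      IsSimplex Triangle bs → IsSimplex Triangle bs′ →
      map (chart α) as ≡ map (chart β) as′ →
      map (chart α) bs ≡ map (chart β) bs′ →
      Σ[ θ ∈ Automorphism ]
        map (Automorphism.to θ) as ≡ as′ × map (Automorphism.to θ) bs ≡ bs′

module _ (𝓑 : Building) where
  open Building 𝓑

  -- The Euclidean distance between x and y, measured in an apartment
  -- containing both, has square d.
  Dist² : Vertex → Vertex → ℤ → Set
  Dist² x y d =
    ∃[ α ] ∃₂ λ a b → chart α a ≡ x × chart α b ≡ y × dist² a b ≡ d

  HasExactly : ℕ → (Vertex → Set) → Set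
  HasExactly n P = Σ[ f ∈ (Fin n → Vertex) ]
    Injective _≡_ _≡_ f × (∀ k → P (f k)) × (∀ z → P z → ∃[ k ] f k ≡ z)

  -- The chambers on the edge {x, y} correspond to their third vertices.
  OfOrder : ℕ → Set
  OfOrder q = ∀ {x y z} → Chamber x y z → HasExactly (suc q) (Chamber x y)

  Thick : Set
  Thick = ∀ {x y z} → Chamber x y z →
    ∃[ z₁ ] ∃₂ λ z₂ z₃ → Chamber x y z₁ × Chamber x y z₂ × Chamber x y z₃
                       × z₁ ≢ z₂ × z₁ ≢ z₃ × z₂ ≢ z₃

  LocallyFinite : Set
  LocallyFinite = ∀ x → Σ[ links ∈ List (Vertex × Vertex) ]
    (∀ {y z} → Chamber x y z → (y , z) ∈ links)

  record TypeRotatingAction (Γ : Group 0ℓ 0ℓ) : Set where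
    open Group Γ
    infixr 5 _▷_
    field
      _▷_         : Carrier → Vertex → Vertex
      ▷-cong      : ∀ {g h} → g ≈ h → ∀ x → g ▷ x ≡ h ▷ x
      ▷-identity  : ∀ x → ε ▷ x ≡ x
      ▷-composite : ∀ g h x → (g ∙ h) ▷ x ≡ g ▷ h ▷ x
      ▷-chamber   : ∀ g {x y z} → Chamber x y z →
                    Chamber (g ▷ x) (g ▷ y) (g ▷ z)
      ▷-rotating  : ∀ g → ∃[ c ] ∀ x →
                    + toℕ (τ (g ▷ x)) ≡₃ + toℕ (τ x) ℤ.+ c

    FreeOnVertices : Set
    FreeOnVertices = ∀ g x → g ▷ x ≡ x → g ≈ ε

    FinitelyManyVertexOrbits : Set
    FinitelyManyVertexOrbits =
      Σ[ xs ∈ List Vertex ] (∀ x → ∃[ g ] (g ▷ x) ∈ xs)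

------------------------------------------------------------------------
-- Parallelograms

Shape : Set
Shape = ℕ × ℕ

infixl 6 _⊕_

_⊕_ : Shape → Shape → Shape
(k₁ , k₂) ⊕ (l₁ , l₂) = k₁ ℕ.+ l₁ , k₂ ℕ.+ l₂

𝟘 : Shape
𝟘 = 0 , 0

e : Fin 2 → Shape
e zero       = 1 , 0
e (suc zero) = 0 , 1

infix 4 _⊑_ _∈𝔭_

_⊑_ : Shape → Shape → Set
(k₁ , k₂) ⊑ (l₁ , l₂) = k₁ ℕ.≤ l₁ × k₂ ℕ.≤ l₂

-- The vertices of 𝔭 m, whose coordinates are all non-negative.
_∈𝔭_ : ℕ × ℕ → Shape → Set
(l₁ , l₂) ∈𝔭 (m₁ , m₂) = l₁ ℕ.≤ suc m₁ × l₂ ℕ.≤ suc m₂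

point : ℕ × ℕ → Pt
point (l₁ , l₂) = + l₁ , + l₂

private
  ∈-translate : ∀ k n {m} → k ⊕ n ⊑ m → ∀ {l} → l ∈𝔭 n → k ⊕ l ∈𝔭 m
  ∈-translate (k₁ , k₂) (n₁ , n₂) (p₁ , p₂) (l₁≤ , l₂≤) =
      bound k₁ n₁ p₁ l₁≤ , bound k₂ n₂ p₂ l₂≤
    where
    bound : ∀ k n {m l} → k ℕ.+ n ℕ.≤ m → l ℕ.≤ suc n → k ℕ.+ l ℕ.≤ suc m
    bound k n p le = ℕ.≤-trans (ℕ.+-monoʳ-≤ k le)
      (ℕ.≤-trans (ℕ.≤-reflexive (ℕ.+-suc k n)) (ℕ.s≤s p))

  sub-translate : ∀ k a b → (k ℤ.+ a) ℤ.- (k ℤ.+ b) ≡ a ℤ.- b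
  sub-translate = solve-∀

  dist-translate : ∀ k l l′ →
    dist² (point (k ⊕ l)) (point (k ⊕ l′)) ≡ dist² (point l) (point l′)
  dist-translate (k₁ , k₂) (l₁ , l₂) (l₁′ , l₂′) = cong ∥_∥²
    (cong₂ _,_ (sub-translate (+ k₁) (+ l₁) (+ l₁′))
               (sub-translate (+ k₂) (+ l₂) (+ l₂′)))

  type-translate : ∀ k₁ k₂ l₁ l₂ c →
    ((k₁ ℤ.+ l₁) ℤ.- (k₂ ℤ.+ l₂)) ℤ.+ c ≡ (l₁ ℤ.- l₂) ℤ.+ ((k₁ ℤ.- k₂) ℤ.+ c)
  type-translate = solve-∀

------------------------------------------------------------------------
-- Words

module Words (𝓑 : Building) {Γ : Group 0ℓ 0ℓ}
             (action : TypeRotatingAction 𝓑 Γ) where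
  open Building 𝓑
  open Group Γ using (_∙_; _⁻¹; ε; inverseˡ)
  open TypeRotatingAction action

  -- Type-rotating isometries 𝔭 m → 𝓑.  An isometry maps triangles of 𝔭 m
  -- affinely onto triangles, so it is determined by its restriction to the
  -- vertices; conversely any two triangles of 𝓑 lie in a common apartment,
  -- so a distance-preserving map of the vertices extends to an isometry.
  record 𝔅 (m : Shape) : Set where
    field
      at        : (l : ℕ × ℕ) → .(l ∈𝔭 m) → Vertex
      isometric : ∀ l l′ .(l∈ : l ∈𝔭 m) .(l′∈ : l′ ∈𝔭 m) →
                  Dist² 𝓑 (at l l∈) (at l′ l′∈) (dist² (point l) (point l′))
      rotating  : ∃[ c ] ∀ l .(l∈ : l ∈𝔭 m) →
                  + toℕ (τ (at l l∈)) ≡₃ type (point l) ℤ.+ c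
  open 𝔅 public

  infix 4 _∼_

  _∼_ : ∀ {m} → 𝔅 m → 𝔅 m → Set
  _∼_ {m} p p′ = ∃[ g ] ∀ l .(l∈ : l ∈𝔭 m) → g ▷ at p l l∈ ≡ at p′ l l∈

  W : Shape → Setoid 0ℓ 0ℓ
  W m = record
    { Carrier = 𝔅 m
    ; _≈_     = _∼_
    ; isEquivalence = record
      { refl  = λ {p} → ε , λ l l∈ → ▷-identity (at p l l∈)
      ; sym   = λ {p} (g , h) → g ⁻¹ , λ l l∈ →
          trans (cong (g ⁻¹ ▷_) (sym (h l l∈)))
         (trans (sym (▷-composite (g ⁻¹) g (at p l l∈)))
         (trans (▷-cong (inverseˡ g) (at p l l∈)) (▷-identity (at p l l∈))))
      ; trans = λ {p} (g , h) (g′ , h′) → g′ ∙ g , λ l l∈ →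
          trans (▷-composite g′ g (at p l l∈))
         (trans (cong (g′ ▷_) (h l l∈)) (h′ l l∈))
      }
    }

  A : Setoid 0ℓ 0ℓ
  A = W 𝟘

  -- The map l ↦ p (k + l) on 𝔭 n.
  window : ∀ k n {m} → .(k ⊕ n ⊑ m) → 𝔅 m → 𝔅 n
  window k n ⊑m p = record
    { at        = λ l l∈ → at p (k ⊕ l) (∈-translate k n ⊑m l∈)
    ; isometric = λ l l′ l∈ l′∈ → subst (Dist² 𝓑 _ _) (dist-translate k l l′)
        (isometric p (k ⊕ l) (k ⊕ l′)
          (∈-translate k n ⊑m l∈) (∈-translate k n ⊑m l′∈))
    ; rotating  = let c , h = rotating p in type (point k) ℤ.+ c , λ l l∈ →
        subst (+ toℕ (τ (at p (k ⊕ l) (∈-translate k n ⊑m l∈))) ≡₃_)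
          (type-translate (+ proj₁ k) (+ proj₂ k) (+ proj₁ l) (+ proj₂ l) c)
          (h (k ⊕ l) (∈-translate k n ⊑m l∈))
    }

  o t : ∀ {m} → 𝔅 m → 𝔅 𝟘
  o         p = window 𝟘 𝟘 (ℕ.z≤n , ℕ.z≤n) p
  t {m} p = window m 𝟘 (ℕ.≤-reflexive (ℕ.+-identityʳ _) ,
                        ℕ.≤-reflexive (ℕ.+-identityʳ _)) p

  -- v is the class uw: it has a representative p′ restricting to u on 𝔭 m
  -- and to w on the translate of 𝔭 (e i) by m, all up to Γ.
  IsProduct : ∀ {m i} → 𝔅 m → 𝔅 (e i) → 𝔅 (m ⊕ e i) → Set
  IsProduct {m} {i} u w v = Σ[ p′ ∈ 𝔅 (m ⊕ e i) ] p′ ∼ v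
    × window 𝟘 m (ℕ.m≤m+n _ _ , ℕ.m≤m+n _ _) p′ ∼ u
    × window m (e i) (ℕ.≤-refl , ℕ.≤-refl) p′ ∼ w

  -- { w ∈ W (e i) ∣ o w = t u }
  Successor : ∀ {m} → 𝔅 m → Fin 2 → Setoid 0ℓ 0ℓ
  Successor u i =
    On.setoid {B = Σ[ w ∈ 𝔅 (e i) ] o w ∼ t u} (W (e i)) proj₁

  -- The function on W, the disjoint union of the W m, determined by g.
  extend : (q : ℕ) .{{_ : ℕ.NonZero q}} →
           Func A ℝ₊-setoid → ∀ m → Func (W m) ℝ₊-setoid
  extend q g m@(m₁ , m₂) = record
    { to   = λ u → q ^- k · Func.to g (o u)
    ; cong = λ {u} {v} (γ , h) →
        ·-cong (q ^- k) {Func.to g (o u)} {Func.to g (o v)}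
          (Func.cong g (γ , λ l l∈ → h l (∈-translate 𝟘 𝟘 {m} (ℕ.z≤n , ℕ.z≤n) l∈)))
    }
    where
    k = 2 ℕ.* (m₁ ℕ.+ m₂)
    instance _ = ^--nonNegative q k

{-# OPTIONS --safe #-}

-- A word u of shape m spans a parallelogram that lies in an apartment.  Extending it by e i
-- means choosing two more vertices at its far corner: the third vertex s of a triangle on the
-- boundary edge {M - E₂, M}, and then the third vertex z of a triangle on {M, s}.  Each edge
-- lies in q + 1 chambers and one of them is excluded because the parallelogram may not fold,
-- which leaves q² choices.  Every choice is realised: an apartment containing the initial
-- triangle of u and {M, s, z} contains the whole hull, hence the parallelogram and both new
-- triangles.  Conversely s and z determine the rest of the new column, since by retraction
-- a neighbour of a vertex that is closer to the origin must be its left or lower neighbour.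
-- As Γ acts freely on vertices, successors of u correspond to the pairs (s , z) and products
-- are unique; every product has the same initial tile as u, so the sum consists of q² equal
-- terms q⁻²⁽ⁿ⁺¹⁾ g̃(o u), where n = m₁ + m₂.
module Submission where

open import Defs
open import Algebra.Bundles using (Group)
open import Data.Empty using (⊥-elim)
open import Data.Fin.Base using (Fin; toℕ; punchIn; punchOut; combine; remQuot)
open import Data.Fin.Properties
  using (punchIn-injective; punchInᵢ≢i; punchIn-punchOut; combine-remQuot; remQuot-combine)
open import Data.Integer.Base as ℤ using (ℤ; +_; -[1+_]; _+_; _*_; _-_)
open import Data.Integer.Divisibility.Signed as Signed using (∣ᵤ⇒∣; ∣⇒∣ᵤ; ∣m∣n⇒∣m+n; ∣n⇒∣m*n)
import Data.Integer.Properties as ℤ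
open import Data.Integer.Tactic.RingSolver using (solve-∀)
open import Data.List.Base using ([]; _∷_; map)
open import Data.List.Membership.Propositional using (_∈_)
open import Data.List.Properties using (∷-injectiveˡ; ∷-injectiveʳ)
open import Data.List.Relation.Unary.Any using (here; there)
open import Data.Nat.Base as ℕ using (ℕ; NonZero; zero; suc)
import Data.Nat.Properties as ℕ
open import Data.Product using (_×_; _,_; proj₁; proj₂; ∃; ∃-syntax; ∃₂; ∃!; Σ-syntax)
open import Data.Rational.Base as ℚ using (0ℚ; 1ℚ; ½)
import Data.Rational.Properties as ℚ
open import Data.Rational.Solver using (module +-*-Solver)
open import Data.Rational.Unnormalised.Base using (mkℚᵘ; *≡*)
import Data.Rational.Unnormalised.Properties as ℚᵘ
open import Data.Sum.Base using (_⊎_; inj₁; inj₂; swap)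
import Data.Vec.Functional as Vector
open import Function.Base using (_∘_)
open import Function.Bundles using (Bijection; Equivalence; Func; Inverse)
open import Level using (0ℓ)
open import Relation.Binary.Bundles using (Setoid)
open import Relation.Binary.PropositionalEquality
  using (_≡_; _≢_; refl; sym; trans; cong; cong₂; subst; subst₂; setoid)
open import Relation.Nullary.Decidable.Core using (Dec; recompute; _×-dec_)

-- The model apartment

-- No axiom says that apartments are convex: `common-apartment` and `apartment-iso` speak of two
-- simplices only, so that a parallelogram lies in an apartment has to be proved. The substitute for
-- convexity is counting steps. In a grid of edges the vertex at (k, l) is joined to the origin by a
-- walk of k + l steps, and one step changes the height x + y by at most one under retraction.
-- Retracting from a triangle at a vertex of the apartment therefore leaves two candidates for a
-- grid neighbour that is one step closer to the origin. What decides between them differs: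
-- preserved distances for a word, `corner-rigid` for a second chart, and the already occupied left
-- neighbour for the new column of a product. Retraction itself rests on rigidity: an automorphism
-- of the model apartment is given as a mere bijection that respects triangles, and it turns out to
-- be affine, hence determined by one triangle.

O E₁ E₂ : Pt
O  = + 0 , + 0
E₁ = + 1 , + 0
E₂ = + 0 , + 1

-- The affine map that sends `O`, `E₁`, `E₂` to the three given points. On a triangle it is an
-- isometry of the lattice, so changing the reference triangle of a chart is precomposition with a
-- frame.
frame : Pt → Pt → Pt → Pt → Pt
frame (a₁ , a₂) (b₁ , b₂) (c₁ , c₂) (v₁ , v₂) =
  a₁ + (v₁ * (b₁ - a₁) + v₂ * (c₁ - a₁)) ,
  a₂ + (v₁ * (b₂ - a₂) + v₂ * (c₂ - a₂))

-- The fourth vertex of a rhombus; on a triangle, the mirror image of the third point in the side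
-- through the first two.
opposite : Pt → Pt → Pt → Pt
opposite (p₁ , p₂) (q₁ , q₂) (r₁ , r₂) = p₁ + q₁ - r₁ , p₂ + q₂ - r₂

dist²-sym : ∀ a b → dist² a b ≡ dist² b a
dist²-sym (a₁ , a₂) (b₁ , b₂) = go a₁ a₂ b₁ b₂
  where
  go : ∀ a₁ a₂ b₁ b₂ →
    (a₁ - b₁) * (a₁ - b₁) + (a₁ - b₁) * (a₂ - b₂) + (a₂ - b₂) * (a₂ - b₂)
    ≡ (b₁ - a₁) * (b₁ - a₁) + (b₁ - a₁) * (b₂ - a₂) + (b₂ - a₂) * (b₂ - a₂)
  go = solve-∀

-- The squared length of a combination of `a - b` and `a - c` depends only on the squared lengths of
-- the three sides, by polarisation, and these are all 1.
frame-isometry : ∀ a b c → Triangle a b c → ∀ v w →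
                 dist² (frame a b c v) (frame a b c w) ≡ dist² v w
frame-isometry a@(a₁ , a₂) b@(b₁ , b₂) c@(c₁ , c₂) (ab , bc , ac) v@(v₁ , v₂) w@(w₁ , w₂) =
  trans (cong ∥_∥² (cong₂ _,_ (difference a₁ b₁ c₁ v₁ v₂ w₁ w₂) (difference a₂ b₂ c₂ v₁ v₂ w₁ w₂)))
  (trans (combination (w₁ - v₁) (w₂ - v₂) (a₁ - b₁) (a₂ - b₂) (a₁ - c₁) (a₂ - c₂))
  (trans (cong₂ _+_ (cong₂ _+_ (cong (d₁ * d₁ *_) ab) (cong (d₂ * d₂ *_) ac))
           (cong (d₁ * d₂ *_) (cong₂ _-_ (cong₂ _+_ ab ac)
             (trans (cong ∥_∥² (cong₂ _,_ (side a₁ b₁ c₁) (side a₂ b₂ c₂))) bc))))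
  (trans (units d₁ d₂) (dist²-sym w v))))
  where
  d₁ = w₁ - v₁
  d₂ = w₂ - v₂
  difference : ∀ a b c v₁ v₂ w₁ w₂ →
    (a + (v₁ * (b - a) + v₂ * (c - a))) - (a + (w₁ * (b - a) + w₂ * (c - a)))
    ≡ (w₁ - v₁) * (a - b) + (w₂ - v₂) * (a - c)
  difference = solve-∀
  side : ∀ a b c → (a - c) - (a - b) ≡ b - c
  side = solve-∀
  combination : ∀ d₁ d₂ x₁ x₂ y₁ y₂ →
    (d₁ * x₁ + d₂ * y₁) * (d₁ * x₁ + d₂ * y₁)
      + (d₁ * x₁ + d₂ * y₁) * (d₁ * x₂ + d₂ * y₂)
      + (d₁ * x₂ + d₂ * y₂) * (d₁ * x₂ + d₂ * y₂)
    ≡ d₁ * d₁ * (x₁ * x₁ + x₁ * x₂ + x₂ * x₂)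
      + d₂ * d₂ * (y₁ * y₁ + y₁ * y₂ + y₂ * y₂)
      + d₁ * d₂ * ((x₁ * x₁ + x₁ * x₂ + x₂ * x₂) + (y₁ * y₁ + y₁ * y₂ + y₂ * y₂)
        - ((y₁ - x₁) * (y₁ - x₁) + (y₁ - x₁) * (y₂ - x₂) + (y₂ - x₂) * (y₂ - x₂)))
  combination = solve-∀
  units : ∀ d₁ d₂ → d₁ * d₁ * + 1 + d₂ * d₂ * + 1 + d₁ * d₂ * (+ 1 + + 1 - + 1)
    ≡ d₁ * d₁ + d₁ * d₂ + d₂ * d₂
  units = solve-∀

-- Quadratic terms cancel in differences of squared distances, which leaves 2x + y and x + 2y. This
-- linear system has determinant 3, and 3 can be cancelled in ℤ.
trilateration : ∀ v w → dist² v O ≡ dist² w O → dist² v E₁ ≡ dist² w E₁ →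
                dist² v E₂ ≡ dist² w E₂ → v ≡ w
trilateration v@(v₁ , v₂) w@(w₁ , w₂) p₀ p₁ p₂ = cong₂ _,_
  (ℤ.*-cancelʳ-≡ v₁ w₁ (+ 3) (trans (first v₁ v₂)
    (trans (cong₂ (λ x y → + 2 * x - y) s₁ s₂) (sym (first w₁ w₂)))))
  (ℤ.*-cancelʳ-≡ v₂ w₂ (+ 3) (trans (second v₁ v₂)
    (trans (cong₂ (λ x y → + 2 * y - x) s₁ s₂) (sym (second w₁ w₂)))))
  where
  along₁ : ∀ x y → + 2 * x + y ≡
    ((x - + 0) * (x - + 0) + (x - + 0) * (y - + 0) + (y - + 0) * (y - + 0))
    - ((x - + 1) * (x - + 1) + (x - + 1) * (y - + 0) + (y - + 0) * (y - + 0)) + + 1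
  along₁ = solve-∀
  along₂ : ∀ x y → x + + 2 * y ≡
    ((x - + 0) * (x - + 0) + (x - + 0) * (y - + 0) + (y - + 0) * (y - + 0))
    - ((x - + 0) * (x - + 0) + (x - + 0) * (y - + 1) + (y - + 1) * (y - + 1)) + + 1
  along₂ = solve-∀
  s₁ : + 2 * v₁ + v₂ ≡ + 2 * w₁ + w₂
  s₁ = trans (along₁ v₁ v₂) (trans (cong₂ (λ x y → x - y + + 1) p₀ p₁) (sym (along₁ w₁ w₂)))
  s₂ : v₁ + + 2 * v₂ ≡ w₁ + + 2 * w₂
  s₂ = trans (along₂ v₁ v₂) (trans (cong₂ (λ x y → x - y + + 1) p₀ p₂) (sym (along₂ w₁ w₂)))
  first : ∀ x y → x * + 3 ≡ + 2 * (+ 2 * x + y) - (x + + 2 * y)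
  first = solve-∀
  second : ∀ x y → y * + 3 ≡ + 2 * (x + + 2 * y) - (+ 2 * x + y)
  second = solve-∀

frame-injective : ∀ a b c → Triangle a b c → ∀ v w → frame a b c v ≡ frame a b c w → v ≡ w
frame-injective a b c abc v w eq = trilateration v w (same O) (same E₁) (same E₂)
  where
  same : ∀ x → dist² v x ≡ dist² w x
  same x = trans (sym (frame-isometry a b c abc v x))
    (trans (cong (λ y → dist² y (frame a b c x)) eq) (frame-isometry a b c abc w x))

-- Cramer's rule. The determinant `D` satisfies D² = 1, so multiplying by `D` replaces the division;
-- indeed 3D² = 4 - 1 for a triangle of unit sides.
frame-surjective : ∀ a b c → Triangle a b c → ∀ p → ∃[ v ] frame a b c v ≡ p
frame-surjective a@(a₁ , a₂) b@(b₁ , b₂) c@(c₁ , c₂) (ab , bc , ac) p@(p₁ , p₂) =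
  (D * ((p₁ - a₁) * (c₂ - a₂) - (p₂ - a₂) * (c₁ - a₁)) ,
   D * ((p₂ - a₂) * (b₁ - a₁) - (p₁ - a₁) * (b₂ - a₂))) ,
  cong₂ _,_
    (trans (cong (λ d → a₁ + d) (cramer₁ (b₁ - a₁) (b₂ - a₂) (c₁ - a₁) (c₂ - a₂) (p₁ - a₁) (p₂ - a₂)))
     (trans (cong (λ d → a₁ + d * (p₁ - a₁)) D²) (back a₁ p₁)))
    (trans (cong (λ d → a₂ + d) (cramer₂ (b₁ - a₁) (b₂ - a₂) (c₁ - a₁) (c₂ - a₂) (p₁ - a₁) (p₂ - a₂)))
     (trans (cong (λ d → a₂ + d * (p₂ - a₂)) D²) (back a₂ p₂)))
  where
  D = (b₁ - a₁) * (c₂ - a₂) - (b₂ - a₂) * (c₁ - a₁)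
  back : ∀ a p → a + + 1 * (p - a) ≡ p
  back = solve-∀
  cramer₁ : ∀ x₁ x₂ y₁ y₂ p₁ p₂ →
    (x₁ * y₂ - x₂ * y₁) * (p₁ * y₂ - p₂ * y₁) * x₁
      + (x₁ * y₂ - x₂ * y₁) * (p₂ * x₁ - p₁ * x₂) * y₁
    ≡ (x₁ * y₂ - x₂ * y₁) * (x₁ * y₂ - x₂ * y₁) * p₁
  cramer₁ = solve-∀
  cramer₂ : ∀ x₁ x₂ y₁ y₂ p₁ p₂ →
    (x₁ * y₂ - x₂ * y₁) * (p₁ * y₂ - p₂ * y₁) * x₂
      + (x₁ * y₂ - x₂ * y₁) * (p₂ * x₁ - p₁ * x₂) * y₂
    ≡ (x₁ * y₂ - x₂ * y₁) * (x₁ * y₂ - x₂ * y₁) * p₂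
  cramer₂ = solve-∀
  -- Lagrange's identity for the form ∥_∥², whose Gram determinant is 3/4.
  lagrange : ∀ x₁ x₂ y₁ y₂ →
    (x₁ * y₂ - x₂ * y₁) * (x₁ * y₂ - x₂ * y₁) * + 3 ≡
    + 4 * (x₁ * x₁ + x₁ * x₂ + x₂ * x₂) * (y₁ * y₁ + y₁ * y₂ + y₂ * y₂)
    - ((x₁ * x₁ + x₁ * x₂ + x₂ * x₂) + (y₁ * y₁ + y₁ * y₂ + y₂ * y₂)
          - ((x₁ - y₁) * (x₁ - y₁) + (x₁ - y₁) * (x₂ - y₂) + (x₂ - y₂) * (x₂ - y₂)))
     * ((x₁ * x₁ + x₁ * x₂ + x₂ * x₂) + (y₁ * y₁ + y₁ * y₂ + y₂ * y₂)
          - ((x₁ - y₁) * (x₁ - y₁) + (x₁ - y₁) * (x₂ - y₂) + (x₂ - y₂) * (x₂ - y₂)))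
  lagrange = solve-∀
  side : ∀ a b c → (b - a) - (c - a) ≡ b - c
  side = solve-∀
  gram : ℤ → ℤ → ℤ → ℤ
  gram x y z = + 4 * x * y - (x + y - z) * (x + y - z)
  gram≡ : ∀ {x y z} → x ≡ + 1 → y ≡ + 1 → z ≡ + 1 → gram x y z ≡ + 3
  gram≡ refl refl refl = refl
  D² : D * D ≡ + 1
  D² = ℤ.*-cancelʳ-≡ (D * D) (+ 1) (+ 3)
    (trans (lagrange (b₁ - a₁) (b₂ - a₂) (c₁ - a₁) (c₂ - a₂))
      (gram≡ (trans (dist²-sym b a) ab) (trans (dist²-sym c a) ac)
        (trans (cong ∥_∥² (cong₂ _,_ (side a₁ b₁ c₁) (side a₂ b₂ c₂))) bc)))

frame-O : ∀ a b c → frame a b c O ≡ a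
frame-O (a₁ , a₂) (b₁ , b₂) (c₁ , c₂) = cong₂ _,_ (go a₁ b₁ c₁) (go a₂ b₂ c₂)
  where
  go : ∀ a b c → a + (+ 0 * (b - a) + + 0 * (c - a)) ≡ a
  go = solve-∀

frame-E₁ : ∀ a b c → frame a b c E₁ ≡ b
frame-E₁ (a₁ , a₂) (b₁ , b₂) (c₁ , c₂) = cong₂ _,_ (go a₁ b₁ c₁) (go a₂ b₂ c₂)
  where
  go : ∀ a b c → a + (+ 1 * (b - a) + + 0 * (c - a)) ≡ b
  go = solve-∀

frame-E₂ : ∀ a b c → frame a b c E₂ ≡ c
frame-E₂ (a₁ , a₂) (b₁ , b₂) (c₁ , c₂) = cong₂ _,_ (go a₁ b₁ c₁) (go a₂ b₂ c₂)
  where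
  go : ∀ a b c → a + (+ 0 * (b - a) + + 1 * (c - a)) ≡ c
  go = solve-∀

frame-opposite : ∀ a b c x y z → frame a b c (opposite x y z) ≡
                 opposite (frame a b c x) (frame a b c y) (frame a b c z)
frame-opposite (a₁ , a₂) (b₁ , b₂) (c₁ , c₂) (x₁ , x₂) (y₁ , y₂) (z₁ , z₂) =
  cong₂ _,_ (go a₁ b₁ c₁ x₁ x₂ y₁ y₂ z₁ z₂) (go a₂ b₂ c₂ x₁ x₂ y₁ y₂ z₁ z₂)
  where
  go : ∀ a b c x₁ x₂ y₁ y₂ z₁ z₂ →
    a + ((x₁ + y₁ - z₁) * (b - a) + (x₂ + y₂ - z₂) * (c - a)) ≡
    (a + (x₁ * (b - a) + x₂ * (c - a))) + (a + (y₁ * (b - a) + y₂ * (c - a)))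
      - (a + (z₁ * (b - a) + z₂ * (c - a)))
  go = solve-∀

frame-standard : ∀ v → frame O E₁ E₂ v ≡ v
frame-standard (v₁ , v₂) = cong₂ _,_ (go₁ v₁ v₂) (go₂ v₁ v₂)
  where
  go₁ : ∀ x y → + 0 + (x * + 1 + y * + 0) ≡ x
  go₁ = solve-∀
  go₂ : ∀ x y → + 0 + (x * + 0 + y * + 1) ≡ y
  go₂ = solve-∀

frame-triangle : ∀ a b c → Triangle a b c → ∀ x y z → Triangle x y z →
                 Triangle (frame a b c x) (frame a b c y) (frame a b c z)
frame-triangle a b c abc x y z (xy , yz , xz) =
  trans (frame-isometry a b c abc x y) xy ,
  trans (frame-isometry a b c abc y z) yz ,
  trans (frame-isometry a b c abc x z) xz

opposite≡frame : ∀ p q r → frame p q r (+ 1 , -[1+ 0 ]) ≡ opposite p q r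
opposite≡frame p q r = trans (frame-opposite p q r O E₁ E₂)
  (trans (cong (λ x → opposite x (frame p q r E₁) (frame p q r E₂)) (frame-O p q r))
   (cong₂ (opposite p) (frame-E₁ p q r) (frame-E₂ p q r)))

triangle-opposite : ∀ p q r → Triangle p q r → Triangle p q (opposite p q r)
triangle-opposite p q r pqr@(pq , _) =
  pq ,
  trans (sym (cong₂ dist² (frame-E₁ p q r) (opposite≡frame p q r))) (frame-isometry p q r pqr E₁ (+ 1 , -[1+ 0 ])) ,
  trans (sym (cong₂ dist² (frame-O p q r) (opposite≡frame p q r))) (frame-isometry p q r pqr O (+ 1 , -[1+ 0 ]))

opposite≢ : ∀ p q r → Triangle p q r → opposite p q r ≢ r
opposite≢ p q r pqr eq = distinct (frame-injective p q r pqr (+ 1 , -[1+ 0 ]) E₂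
  (trans (opposite≡frame p q r) (trans eq (sym (frame-E₂ p q r)))))
  where
  distinct : (+ 1 , -[1+ 0 ]) ≢ E₂
  distinct ()

-- In the coordinates of the frame on `p`, `q`, `r`, subtracting the two distance equations gives y
-- = 1 - 2x; substituting this back gives 3x(x - 1) = 0.
third-vertex : ∀ p q r t → Triangle p q r → Triangle p q t → t ≡ r ⊎ t ≡ opposite p q r
third-vertex p q r t pqr (_ , qt , pt) =
  let v@(x , y) , eq = frame-surjective p q r pqr t
      vO = trans (sym (frame-isometry p q r pqr v O))
             (trans (cong₂ dist² eq (frame-O p q r)) (trans (dist²-sym t p) pt))
      vE₁ = trans (sym (frame-isometry p q r pqr v E₁))
             (trans (cong₂ dist² eq (frame-E₁ p q r)) (trans (dist²-sym t q) qt))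
  in solution x y eq (trans (along x y) (cong₂ (λ a b → + 1 + (a - b) - + 2 * x) vO vE₁)) vO
  where
  along : ∀ x y → y ≡ + 1 +
    (((x - + 0) * (x - + 0) + (x - + 0) * (y - + 0) + (y - + 0) * (y - + 0))
    - ((x - + 1) * (x - + 1) + (x - + 1) * (y - + 0) + (y - + 0) * (y - + 0))) - + 2 * x
  along = solve-∀
  product : ∀ x → x * (x - + 1) * + 3 ≡
    (x - + 0) * (x - + 0) + (x - + 0) * ((+ 1 - + 2 * x) - + 0) + ((+ 1 - + 2 * x) - + 0) * ((+ 1 - + 2 * x) - + 0) - + 1
  product = solve-∀
  back : ∀ {x y v} → (x , y) ≡ v → frame p q r (x , y) ≡ t → t ≡ frame p q r v
  back refl eq = sym eq
  cases : ∀ x y → frame p q r (x , y) ≡ t → y ≡ + 1 - + 2 * x → x ≡ + 0 ⊎ x - + 1 ≡ + 0 →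
          t ≡ r ⊎ t ≡ opposite p q r
  cases x y eq y≡ (inj₁ x≡0) = inj₁ (trans
    (back (cong₂ _,_ x≡0 (trans y≡ (cong (λ z → + 1 - + 2 * z) x≡0))) eq) (frame-E₂ p q r))
  cases x y eq y≡ (inj₂ x≡1) = let x≡1 = ℤ.i-j≡0⇒i≡j x (+ 1) x≡1 in inj₂ (trans
    (back (cong₂ _,_ x≡1 (trans y≡ (cong (λ z → + 1 - + 2 * z) x≡1))) eq) (opposite≡frame p q r))
  solution : ∀ x y → frame p q r (x , y) ≡ t → y ≡ + 1 - + 2 * x → dist² (x , y) O ≡ + 1 →
             t ≡ r ⊎ t ≡ opposite p q r
  solution x y eq y≡ unit = cases x y eq y≡
    (ℤ.i*j≡0⇒i≡0∨j≡0 x (ℤ.*-cancelʳ-≡ (x * (x - + 1)) (+ 0) (+ 3)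
      (trans (product x) (cong (_- + 1) (trans (cong (λ z → dist² (x , z) O) (sym y≡)) unit)))))

-- Since 4(x² + xy + y²) = 3(x + y)² + (x - y)², a sum of 2 or more would force 12 ≤ 4.
unit-sum : ∀ x y → ∥ x , y ∥² ≡ + 1 → x + y ℤ.≤ + 1
unit-sum x y unit = bound (x + y) refl
  where
  square : ∀ i → ∃[ k ] i * i ≡ + k
  square (+ n)    = n ℕ.* n , sym (ℤ.pos-* n n)
  square -[1+ n ] = _ , refl
  complete : ∀ x y → + 4 * (x * x + x * y + y * y) ≡ + 3 * ((x + y) * (x + y)) + (x - y) * (x - y)
  complete = solve-∀
  bound : ∀ s → x + y ≡ s → s ℤ.≤ + 1
  bound -[1+ n ]          _  = ℤ.-≤+
  bound (+ zero)          _  = ℤ.+≤+ ℕ.z≤n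
  bound (+ suc zero)      _  = ℤ.+≤+ (ℕ.s≤s ℕ.z≤n)
  bound (+ suc (suc n))   eq =
    let k , k≡ = square (x - y)
        4≡ : 4 ≡ 3 ℕ.* (suc (suc n) ℕ.* suc (suc n)) ℕ.+ k
        4≡ = ℤ.+-injective (trans (sym (cong (+ 4 *_) unit)) (trans (complete x y)
               (cong₂ _+_ (trans (cong (+ 3 *_) (trans (cong₂ _*_ eq eq) (sym (ℤ.pos-* (suc (suc n)) (suc (suc n))))))
                            (sym (ℤ.pos-* 3 (suc (suc n) ℕ.* suc (suc n))))) k≡)))
        12≤ : 12 ℕ.≤ 4
        12≤ = ℕ.≤-trans (ℕ.*-monoʳ-≤ 3 (ℕ.*-mono-≤ {2} {suc (suc n)} {2} {suc (suc n)}
                 (ℕ.s≤s (ℕ.s≤s ℕ.z≤n)) (ℕ.s≤s (ℕ.s≤s ℕ.z≤n))))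
               (ℕ.≤-trans (ℕ.m≤m+n (3 ℕ.* (suc (suc n) ℕ.* suc (suc n))) k) (ℕ.≤-reflexive (sym 4≡)))
    in ⊥-elim (ℕ.<⇒≱ (ℕ.s≤s (ℕ.m≤m+n 4 7)) 12≤)

unit-sum-1 : ∀ x y → ∥ x , y ∥² ≡ + 1 → x + y ≡ + 1 → (x , y) ≡ E₁ ⊎ (x , y) ≡ E₂
unit-sum-1 x y unit sum
  with ℤ.i*j≡0⇒i≡0∨j≡0 x (trans (product x y)
         (trans (cong₂ (λ n s → n - + 1 + (x - (s + + 1)) * (s - + 1)) unit sum)
                (cong (λ z → + 0 + z) (ℤ.*-zeroʳ (x - + 2)))))
  where
  -- When the norm and the sum are both 1, the right side vanishes and leaves x(x - 1) = 0.
  product : ∀ x y → x * (x - + 1) ≡ (x * x + x * y + y * y) - + 1 + (x - ((x + y) + + 1)) * ((x + y) - + 1)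
  product = solve-∀
... | inj₁ refl = inj₂ (cong (λ y → + 0 , y) (trans (sym (ℤ.+-identityˡ y)) sum))
... | inj₂ x≡1 with ℤ.i-j≡0⇒i≡j x (+ 1) x≡1
...   | refl = inj₁ (cong (λ y → + 1 , y) (trans (isolate y) (cong (_- + 1) sum)))
  where
  isolate : ∀ y → y ≡ + 1 + y - + 1
  isolate = solve-∀

-- Translations, reflections and automorphisms of the model apartment

infixr 6 _⊞_

_⊞_ : Pt → Pt → Pt
(k₁ , k₂) ⊞ (v₁ , v₂) = k₁ + v₁ , k₂ + v₂

⊞-assoc : ∀ k l v → (k ⊞ l) ⊞ v ≡ k ⊞ l ⊞ v
⊞-assoc (k₁ , k₂) (l₁ , l₂) (v₁ , v₂) = cong₂ _,_ (ℤ.+-assoc k₁ l₁ v₁) (ℤ.+-assoc k₂ l₂ v₂)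

⊞-dist² : ∀ k l v → dist² (k ⊞ v) (l ⊞ v) ≡ dist² k l
⊞-dist² (k₁ , k₂) (l₁ , l₂) (v₁ , v₂) = cong ∥_∥² (cong₂ _,_ (cancel k₁ l₁ v₁) (cancel k₂ l₂ v₂))
  where
  cancel : ∀ k l v → (k + v) - (l + v) ≡ k - l
  cancel = solve-∀

⊞-opposite : ∀ x y z v → opposite (x ⊞ v) (y ⊞ v) (z ⊞ v) ≡ opposite x y z ⊞ v
⊞-opposite (x₁ , x₂) (y₁ , y₂) (z₁ , z₂) (v₁ , v₂) = cong₂ _,_ (go x₁ y₁ z₁ v₁) (go x₂ y₂ z₂ v₂)
  where
  go : ∀ x y z v → (x + v) + (y + v) - (z + v) ≡ (x + y - z) + v
  go = solve-∀

-- Every vertex is reached from one triangle by reflecting it in its sides.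
module ReflectionInduction (P : Pt → Set)
  (reflect : ∀ x y z → Triangle x y z → P x → P y → P z → P (opposite x y z))
  (PO : P O) (PE₁ : P E₁) (PE₂ : P E₂) where

  private
    -- A reflection consumes a whole triangle, so the induction carries all three vertices of the
    -- triangle at `v`. Two reflections move that triangle by one unit along an axis.
    Near : Pt → Set
    Near v = P (O ⊞ v) × P (E₁ ⊞ v) × P (E₂ ⊞ v)

    reflect′ : ∀ x y z v → Triangle x y z → P (x ⊞ v) → P (y ⊞ v) → P (z ⊞ v) → P (opposite x y z ⊞ v)
    reflect′ x y z v (xy , yz , xz) px py pz = subst P (⊞-opposite x y z v)
      (reflect (x ⊞ v) (y ⊞ v) (z ⊞ v)
        (trans (⊞-dist² x y v) xy , trans (⊞-dist² y z v) yz , trans (⊞-dist² x z v) xz) px py pz)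

    E₁₂ E₂₁ : Pt
    E₁₂ = + 1 , -[1+ 0 ]
    E₂₁ = -[1+ 0 ] , + 1

    shift : ∀ k v → P ((O ⊞ k) ⊞ v) → P ((E₁ ⊞ k) ⊞ v) → P ((E₂ ⊞ k) ⊞ v) → Near (k ⊞ v)
    shift k v p₀ p₁ p₂ =
      subst P (⊞-assoc O k v) p₀ , subst P (⊞-assoc E₁ k v) p₁ , subst P (⊞-assoc E₂ k v) p₂

    up₁ : ∀ v → Near v → Near (E₁ ⊞ v)
    up₁ v (p₀ , p₁ , p₂) =
      let p₁₂ = reflect′ E₁ E₂ O v (refl , refl , refl) p₁ p₂ p₀
      in shift E₁ v p₁ (reflect′ E₁ (+ 1 , + 1) E₂ v (refl , refl , refl) p₁ p₁₂ p₂) p₁₂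

    up₂ : ∀ v → Near v → Near (E₂ ⊞ v)
    up₂ v (p₀ , p₁ , p₂) =
      let p₁₂ = reflect′ E₁ E₂ O v (refl , refl , refl) p₁ p₂ p₀
      in shift E₂ v p₂ p₁₂ (reflect′ E₂ (+ 1 , + 1) E₁ v (refl , refl , refl) p₂ p₁₂ p₁)

    down₁ : ∀ v → Near v → Near ((-[1+ 0 ] , + 0) ⊞ v)
    down₁ v (p₀ , p₁ , p₂) =
      let p₂₁ = reflect′ O E₂ E₁ v (refl , refl , refl) p₀ p₂ p₁
      in shift (-[1+ 0 ] , + 0) v (reflect′ O E₂₁ E₂ v (refl , refl , refl) p₀ p₂₁ p₂) p₀ p₂₁

    down₂ : ∀ v → Near v → Near ((+ 0 , -[1+ 0 ]) ⊞ v)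
    down₂ v (p₀ , p₁ , p₂) =
      let p₁₂ = reflect′ O E₁ E₂ v (refl , refl , refl) p₀ p₁ p₂
      in shift (+ 0 , -[1+ 0 ]) v (reflect′ O E₁₂ E₁ v (refl , refl , refl) p₀ p₁₂ p₁) p₁₂ p₀

    near-column : ∀ y → Near (+ 0 , y)
    near-column (+ zero)     = PO , PE₁ , PE₂
    near-column (+ suc n)    = up₂ (+ 0 , + n) (near-column (+ n))
    near-column -[1+ zero ]  = down₂ (+ 0 , + 0) (near-column (+ 0))
    near-column -[1+ suc n ] = down₂ (+ 0 , -[1+ n ]) (near-column -[1+ n ])

    shifted : ∀ x y → Near (x , + 0 + y) → Near (x , y)
    shifted x y = subst (λ y → Near (x , y)) (ℤ.+-identityˡ y)

    near : ∀ x y → Near (x , y)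
    near (+ zero)     y = near-column y
    near (+ suc n)    y = shifted (+ suc n) y (up₁ (+ n , y) (near (+ n) y))
    near -[1+ zero ]  y = shifted -[1+ 0 ] y (down₁ (+ 0 , y) (near (+ 0) y))
    near -[1+ suc n ] y = shifted -[1+ suc n ] y (down₁ (-[1+ n ] , y) (near -[1+ n ] y))

  everywhere : ∀ v → P v
  everywhere (x , y) = subst P (cong₂ _,_ (ℤ.+-identityˡ x) (ℤ.+-identityˡ y)) (proj₁ (near x y))

module _ (θ : Automorphism) where
  open Automorphism θ

  to-injective : ∀ {x y} → to x ≡ to y → x ≡ y
  to-injective {x} {y} eq = trans (sym (inverseʳ′ x)) (trans (cong from eq) (inverseʳ′ y))
    where
    from = Inverse.from bijection
    inverseʳ′ : ∀ x → from (to x) ≡ x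
    inverseʳ′ x = Inverse.inverseʳ bijection refl

  to-triangle : ∀ x y z → Triangle x y z → Triangle (to x) (to y) (to z)
  to-triangle x y z = Equivalence.to (simplicial {x} {y} {z})

  -- Only two triangles stand on the image of the side `x y`, and injectivity excludes the one with
  -- third vertex `to z`.
  to-opposite : ∀ x y z → Triangle x y z → to (opposite x y z) ≡ opposite (to x) (to y) (to z)
  to-opposite x y z xyz = choose (third-vertex (to x) (to y) (to z) (to (opposite x y z))
      (to-triangle x y z xyz) (to-triangle x y (opposite x y z) (triangle-opposite x y z xyz)))
    where
    choose : to (opposite x y z) ≡ to z ⊎ to (opposite x y z) ≡ opposite (to x) (to y) (to z) →
             to (opposite x y z) ≡ opposite (to x) (to y) (to z)
    choose (inj₁ eq) = ⊥-elim (opposite≢ x y z xyz (to-injective eq))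
    choose (inj₂ eq) = eq

  -- Both sides agree at `O`, `E₁`, `E₂` and commute with `opposite`, so reflections spread the
  -- agreement: every automorphism is affine.
  to-frame : ∀ a b c → Triangle a b c → ∀ v → to (frame a b c v) ≡ frame (to a) (to b) (to c) v
  to-frame a b c abc = ReflectionInduction.everywhere
    (λ v → to (frame a b c v) ≡ frame (to a) (to b) (to c) v) reflect
    (trans (cong to (frame-O a b c)) (sym (frame-O (to a) (to b) (to c))))
    (trans (cong to (frame-E₁ a b c)) (sym (frame-E₁ (to a) (to b) (to c))))
    (trans (cong to (frame-E₂ a b c)) (sym (frame-E₂ (to a) (to b) (to c))))
    where
    F  = frame a b c
    F′ = frame (to a) (to b) (to c)
    reflect : ∀ x y z → Triangle x y z → to (F x) ≡ F′ x → to (F y) ≡ F′ y → to (F z) ≡ F′ z →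
              to (F (opposite x y z)) ≡ F′ (opposite x y z)
    reflect x y z xyz px py pz =
      trans (cong to (frame-opposite a b c x y z))
      (trans (to-opposite (F x) (F y) (F z) (frame-triangle a b c abc x y z xyz))
      (trans (trans (cong (λ w → opposite w (to (F y)) (to (F z))) px) (cong₂ (opposite (F′ x)) py pz))
             (sym (frame-opposite (to a) (to b) (to c) x y z))))

  to-isometry : ∀ v w → dist² (to v) (to w) ≡ dist² v w
  to-isometry v w =
    trans (cong₂ dist² (standard v) (standard w))
          (frame-isometry (to O) (to E₁) (to E₂) (to-triangle O E₁ E₂ (refl , refl , refl)) v w)
    where
    standard : ∀ v → to v ≡ frame (to O) (to E₁) (to E₂) v
    standard v = trans (cong to (sym (frame-standard v))) (to-frame O E₁ E₂ (refl , refl , refl) v)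

-- Charts of a building

edge-of-triangle : ∀ {p q r} → Triangle p q r → ∀ {x y} →
  x ∈ p ∷ q ∷ r ∷ [] → y ∈ p ∷ q ∷ r ∷ [] → x ≢ y → dist² x y ≡ + 1
edge-of-triangle (pq , qr , pr) (here refl) (here refl) x≢y = ⊥-elim (x≢y refl)
edge-of-triangle (pq , qr , pr) (here refl) (there (here refl)) x≢y = pq
edge-of-triangle (pq , qr , pr) (here refl) (there (there (here refl))) x≢y = pr
edge-of-triangle {p} {q} (pq , qr , pr) (there (here refl)) (here refl) x≢y = trans (dist²-sym q p) pq
edge-of-triangle (pq , qr , pr) (there (here refl)) (there (here refl)) x≢y = ⊥-elim (x≢y refl)
edge-of-triangle (pq , qr , pr) (there (here refl)) (there (there (here refl))) x≢y = qr
edge-of-triangle {p} {q} {r} (pq , qr , pr) (there (there (here refl))) (here refl) x≢y = trans (dist²-sym r p) pr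
edge-of-triangle {p} {q} {r} (pq , qr , pr) (there (there (here refl))) (there (here refl)) x≢y = trans (dist²-sym r q) qr
edge-of-triangle (pq , qr , pr) (there (there (here refl))) (there (there (here refl))) x≢y = ⊥-elim (x≢y refl)

triangle-of-simplex : ∀ {a b c} → IsSimplex Triangle (a ∷ b ∷ c ∷ []) →
                      a ≢ b → b ≢ c → a ≢ c → Triangle a b c
triangle-of-simplex (_ , _ , _ , pqr , ⊆) a≢b b≢c a≢c =
  edge-of-triangle pqr (⊆ (here refl)) (⊆ (there (here refl))) a≢b ,
  edge-of-triangle pqr (⊆ (there (here refl))) (⊆ (there (there (here refl)))) b≢c ,
  edge-of-triangle pqr (⊆ (here refl)) (⊆ (there (there (here refl)))) a≢c

triangle-at : ∀ v → Triangle (O ⊞ v) (E₁ ⊞ v) (E₂ ⊞ v)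
triangle-at v = ⊞-dist² O E₁ v , ⊞-dist² E₁ E₂ v , ⊞-dist² O E₂ v

point-simplex : ∀ v → IsSimplex Triangle (v ∷ [])
point-simplex v = O ⊞ v , E₁ ⊞ v , E₂ ⊞ v , triangle-at v ,
  λ { (here refl) → here (sym (cong₂ _,_ (ℤ.+-identityˡ (proj₁ v)) (ℤ.+-identityˡ (proj₂ v)))) }

triangle-simplex : ∀ {a b c} → Triangle a b c → IsSimplex Triangle (a ∷ b ∷ c ∷ [])
triangle-simplex abc = _ , _ , _ , abc , λ p → p

module Charts (𝓑 : Building) where
  open Building 𝓑

  Adj : Vertex → Vertex → Set
  Adj x y = ∃[ z ] Chamber x y z

  chamber-≢ : ∀ {x y z} → Chamber x y z → x ≢ y
  chamber-≢ xyz x≡y = chamber-types xyz (cong τ x≡y)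

  adj-sym : ∀ {x y} → Adj x y → Adj y x
  adj-sym (z , xyz) = z , chamber-swap xyz

  chamber-simplex : ∀ {x y z} → Chamber x y z → IsSimplex Chamber (x ∷ y ∷ z ∷ [])
  chamber-simplex xyz = _ , _ , _ , xyz , λ p → p

  -- An apartment with a marked ordered triangle, so that origin and axes can be put on any of its
  -- chambers in any order. The price is that such a chart may permute the types.
  record Chart : Set where
    constructor mkChart
    field
      apartment : Apartment
      a b c     : Pt
      corner    : Triangle a b c

  ⟦_⟧ : Chart → Pt → Vertex
  ⟦ mkChart α a b c _ ⟧ v = chart α (frame a b c v)

  Cornered : Chart → Vertex → Vertex → Vertex → Set
  Cornered φ x y z = ⟦ φ ⟧ O ≡ x × ⟦ φ ⟧ E₁ ≡ y × ⟦ φ ⟧ E₂ ≡ z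

  ⟦⟧-chamber : ∀ φ x y z → Triangle x y z → Chamber (⟦ φ ⟧ x) (⟦ φ ⟧ y) (⟦ φ ⟧ z)
  ⟦⟧-chamber (mkChart α a b c abc) x y z xyz = chart-chamber α (frame-triangle a b c abc x y z xyz)

  ⟦⟧-dist² : ∀ φ v w → Dist² 𝓑 (⟦ φ ⟧ v) (⟦ φ ⟧ w) (dist² v w)
  ⟦⟧-dist² (mkChart α a b c abc) v w =
    α , frame a b c v , frame a b c w , refl , refl , frame-isometry a b c abc v w

  private
    frame-chart : ∀ α a b c (abc : Triangle a b c) →
      Cornered (mkChart α a b c abc) (chart α a) (chart α b) (chart α c)
    frame-chart α a b c abc =
      cong (chart α) (frame-O a b c) , cong (chart α) (frame-E₁ a b c) , cong (chart α) (frame-E₂ a b c)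

    at-corner : ∀ {x y z} α as → map (chart α) as ≡ x ∷ y ∷ z ∷ [] → Chamber x y z →
      IsSimplex Triangle as →
      Σ[ φ ∈ Chart ] Chart.apartment φ ≡ α × Cornered φ x y z
    at-corner α (a ∷ b ∷ c ∷ []) refl xyz S =
      let abc = triangle-of-simplex S (λ e → chamber-≢ xyz (cong (chart α) e))
                  (λ e → chamber-≢ (chamber-rotate xyz) (cong (chart α) e))
                  (λ e → chamber-≢ (chamber-rotate (chamber-rotate xyz)) (cong (chart α) (sym e)))
      in mkChart α a b c abc , refl , frame-chart α a b c abc

  chart-coordinates : ∀ φ p → ∃[ v ] ⟦ φ ⟧ v ≡ chart (Chart.apartment φ) p
  chart-coordinates (mkChart α a b c abc) p =
    let v , eq = frame-surjective a b c abc p in v , cong (chart α) eq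

  private
    coordinates : ∀ φ {α} → Chart.apartment φ ≡ α → ∀ p → ∃[ v ] ⟦ φ ⟧ v ≡ chart α p
    coordinates φ refl = chart-coordinates φ

  chart-to-chamber : ∀ {x y z x′ y′ z′} → Chamber x y z → Chamber x′ y′ z′ →
    Σ[ φ ∈ Chart ] Cornered φ x y z × ∃[ u ] ∃₂ λ v w → ⟦ φ ⟧ u ≡ x′ × ⟦ φ ⟧ v ≡ y′ × ⟦ φ ⟧ w ≡ z′
  chart-to-chamber {x} {y} {z} {x′} {y′} {z′} xyz xyz′ =
    let α , as , bs , (S , p) , (_ , q) = common-apartment (chamber-simplex xyz) (chamber-simplex xyz′)
        φ , φ-α , φ-corner = at-corner α as p xyz S
    in φ , φ-corner , locate α bs q φ φ-α
    where
    locate : ∀ α bs → map (chart α) bs ≡ x′ ∷ y′ ∷ z′ ∷ [] → ∀ φ → Chart.apartment φ ≡ α →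
             ∃[ u ] ∃₂ λ v w → ⟦ φ ⟧ u ≡ x′ × ⟦ φ ⟧ v ≡ y′ × ⟦ φ ⟧ w ≡ z′
    locate α (a ∷ b ∷ c ∷ []) refl φ eq =
      let u , pu = coordinates φ eq a ; v , pv = coordinates φ eq b ; w , pw = coordinates φ eq c
      in u , v , w , pu , pv , pw

  chart-to-vertex : ∀ {x y z} → Chamber x y z → ∀ x′ →
    Σ[ φ ∈ Chart ] Cornered φ x y z × ∃[ v ] ⟦ φ ⟧ v ≡ x′
  chart-to-vertex xyz x′ =
    let _ , _ , xyz′ = chamber-cover x′
        φ , φ-corner , v , _ , _ , eq , _ = chart-to-chamber xyz xyz′
    in φ , φ-corner , v , eq

  -- Makes `Dist²` independent of the apartment: `apartment-iso` is applied to the two points as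
  -- one-vertex simplices, and automorphisms are isometries.
  chart-dist² : ∀ α β {a b a′ b′} → chart α a ≡ chart β a′ → chart α b ≡ chart β b′ →
                dist² a b ≡ dist² a′ b′
  chart-dist² α β {a} {b} {a′} {b′} p q =
    let θ , θa , θb = apartment-iso α β (point-simplex a) (point-simplex a′)
                        (point-simplex b) (point-simplex b′) (cong (_∷ []) p) (cong (_∷ []) q)
    in trans (sym (to-isometry θ a b)) (cong₂ dist² (∷-injectiveˡ θa) (∷-injectiveˡ θb))

  Dist²-unique : ∀ {x y d d′} → Dist² 𝓑 x y d → Dist² 𝓑 x y d′ → d ≡ d′
  Dist²-unique (α , a , b , refl , refl , refl) (β , a′ , b′ , p , q , refl) =
    chart-dist² α β (sym p) (sym q)

  -- The isomorphism that matches both corners and the common vertex is affine, so in frame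
  -- coordinates it is the identity. This makes the retraction at a chamber well defined and, for
  -- `φ` equal to `ψ`, shows that a chart is injective.
  corner-rigid : ∀ φ ψ {x y z} → Cornered φ x y z → Cornered ψ x y z →
                 ∀ v v′ → ⟦ φ ⟧ v ≡ ⟦ ψ ⟧ v′ → v ≡ v′
  corner-rigid φ@(mkChart α a b c abc) ψ@(mkChart β a′ b′ c′ abc′) (p₀ , p₁ , p₂) (q₀ , q₁ , q₂) v v′ eq =
    let θ , θabc , θv = apartment-iso α β (triangle-simplex abc) (triangle-simplex abc′)
          (point-simplex (frame a b c v)) (point-simplex (frame a′ b′ c′ v′))
          (cong₂ _∷_ (same (frame-O a b c) (frame-O a′ b′ c′) (trans p₀ (sym q₀)))
            (cong₂ _∷_ (same (frame-E₁ a b c) (frame-E₁ a′ b′ c′) (trans p₁ (sym q₁)))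
              (cong (_∷ []) (same (frame-E₂ a b c) (frame-E₂ a′ b′ c′) (trans p₂ (sym q₂))))))
          (cong (_∷ []) eq)
        θa = ∷-injectiveˡ θabc
        θb = ∷-injectiveˡ (∷-injectiveʳ θabc)
        θc = ∷-injectiveˡ (∷-injectiveʳ (∷-injectiveʳ θabc))
    in frame-injective a′ b′ c′ abc′ v v′
         (trans (sym (trans (to-frame θ a b c abc v)
           (trans (cong (λ x → frame x (Automorphism.to θ b) (Automorphism.to θ c) v) θa)
                  (cong₂ (λ y z → frame a′ y z v) θb θc))))
           (∷-injectiveˡ θv))
    where
    same : ∀ {r s r′ s′} → r ≡ s → r′ ≡ s′ → chart α r ≡ chart β r′ → chart α s ≡ chart β s′
    same refl refl e = e

  adj-dist² : ∀ {x y} → Adj x y → Dist² 𝓑 x y (+ 1)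
  adj-dist² (z , xyz) =
    let φ , (p , q , _) , _ = chart-to-chamber xyz xyz
    in subst₂ (λ x y → Dist² 𝓑 x y (+ 1)) p q (⟦⟧-dist² φ O E₁)
  ⟦⟧-reflects-adj : ∀ φ v w → Adj (⟦ φ ⟧ v) (⟦ φ ⟧ w) → dist² v w ≡ + 1
  ⟦⟧-reflects-adj φ v w adj = Dist²-unique (⟦⟧-dist² φ v w) (adj-dist² adj)

  ⟦⟧-adj : ∀ φ v w → dist² v w ≡ + 1 → Adj (⟦ φ ⟧ v) (⟦ φ ⟧ w)
  ⟦⟧-adj φ v w unit = ⟦ φ ⟧ (turn v w) , ⟦⟧-chamber φ v w (turn v w) (unit , turn-dist v w unit)
    where
    -- Rotation of the second point about the first by π/3, which completes a unit edge to a
    -- triangle.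
    turn : Pt → Pt → Pt
    turn (v₁ , v₂) (w₁ , w₂) = v₁ + (v₂ - w₂) , v₂ + ((w₁ - v₁) + (w₂ - v₂))
    turn-dist : ∀ v w → dist² v w ≡ + 1 → dist² w (turn v w) ≡ + 1 × dist² v (turn v w) ≡ + 1
    turn-dist (v₁ , v₂) (w₁ , w₂) unit = trans (first v₁ v₂ w₁ w₂) unit , trans (second v₁ v₂ w₁ w₂) unit
      where
      first : ∀ v₁ v₂ w₁ w₂ →
        (w₁ - (v₁ + (v₂ - w₂))) * (w₁ - (v₁ + (v₂ - w₂)))
          + (w₁ - (v₁ + (v₂ - w₂))) * (w₂ - (v₂ + ((w₁ - v₁) + (w₂ - v₂))))
          + (w₂ - (v₂ + ((w₁ - v₁) + (w₂ - v₂)))) * (w₂ - (v₂ + ((w₁ - v₁) + (w₂ - v₂))))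
        ≡ (v₁ - w₁) * (v₁ - w₁) + (v₁ - w₁) * (v₂ - w₂) + (v₂ - w₂) * (v₂ - w₂)
      first = solve-∀
      second : ∀ v₁ v₂ w₁ w₂ →
        (v₁ - (v₁ + (v₂ - w₂))) * (v₁ - (v₁ + (v₂ - w₂)))
          + (v₁ - (v₁ + (v₂ - w₂))) * (v₂ - (v₂ + ((w₁ - v₁) + (w₂ - v₂))))
          + (v₂ - (v₂ + ((w₁ - v₁) + (w₂ - v₂)))) * (v₂ - (v₂ + ((w₁ - v₁) + (w₂ - v₂))))
        ≡ (v₁ - w₁) * (v₁ - w₁) + (v₁ - w₁) * (v₂ - w₂) + (v₂ - w₂) * (v₂ - w₂)
      second = solve-∀

  Dist²-adj : ∀ {x y} → Dist² 𝓑 x y (+ 1) → Adj x y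
  Dist²-adj (α , a , b , p , q , unit) = subst₂ Adj p q (chart-adj a b unit)
    where
    chart-adj : ∀ a b → dist² a b ≡ + 1 → Adj (chart α a) (chart α b)
    chart-adj a b unit = subst₂ Adj (cong (chart α) (frame-standard a)) (cong (chart α) (frame-standard b))
      (⟦⟧-adj (mkChart α O E₁ E₂ (refl , refl , refl)) a b unit)

  -- A chart through a chamber on `x y` and through `z` turns the other two adjacencies into unit
  -- distances, and three unit distances in the plane make a triangle.
  flag : ∀ {x y z} → Adj x y → Adj y z → Adj x z → Chamber x y z
  flag {x} {y} {z} (w , xyw) yz xz =
    let φ , (p , q , _) , v , r = chart-to-vertex xyw z in close φ v p q r
    where
    close : ∀ φ v → ⟦ φ ⟧ O ≡ x → ⟦ φ ⟧ E₁ ≡ y → ⟦ φ ⟧ v ≡ z → Chamber x y z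
    close φ v refl refl refl =
      ⟦⟧-chamber φ O E₁ v (refl , ⟦⟧-reflects-adj φ E₁ v yz , ⟦⟧-reflects-adj φ O v xz)

frame-frame : ∀ a b c p q r v → frame (frame a b c p) (frame a b c q) (frame a b c r) v ≡
                                frame a b c (frame p q r v)
frame-frame (a₁ , a₂) (b₁ , b₂) (c₁ , c₂) (p₁ , p₂) (q₁ , q₂) (r₁ , r₂) (v₁ , v₂) =
  cong₂ _,_ (trans (linear a₁ (v₁) v₂ (p₁ * (b₁ - a₁)) (p₂ * (c₁ - a₁)) (q₁ * (b₁ - a₁)) (q₂ * (c₁ - a₁))
                     (r₁ * (b₁ - a₁)) (r₂ * (c₁ - a₁)))
                   (cong (λ x → a₁ + x) (collect v₁ v₂ p₁ p₂ q₁ q₂ r₁ r₂ (b₁ - a₁) (c₁ - a₁))))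
            (trans (linear a₂ (v₁) v₂ (p₁ * (b₂ - a₂)) (p₂ * (c₂ - a₂)) (q₁ * (b₂ - a₂)) (q₂ * (c₂ - a₂))
                     (r₁ * (b₂ - a₂)) (r₂ * (c₂ - a₂)))
                   (cong (λ x → a₂ + x) (collect v₁ v₂ p₁ p₂ q₁ q₂ r₁ r₂ (b₂ - a₂) (c₂ - a₂))))
  where
  linear : ∀ a v₁ v₂ x x′ y y′ z z′ →
    (a + (x + x′)) + (v₁ * ((a + (y + y′)) - (a + (x + x′))) + v₂ * ((a + (z + z′)) - (a + (x + x′))))
    ≡ a + (x + x′ + (v₁ * (y + y′ - (x + x′)) + v₂ * (z + z′ - (x + x′))))
  linear = solve-∀
  collect : ∀ v₁ v₂ p₁ p₂ q₁ q₂ r₁ r₂ b c →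
    p₁ * b + p₂ * c + (v₁ * (q₁ * b + q₂ * c - (p₁ * b + p₂ * c)) + v₂ * (r₁ * b + r₂ * c - (p₁ * b + p₂ * c)))
    ≡ (p₁ + (v₁ * (q₁ - p₁) + v₂ * (r₁ - p₁))) * b + (p₂ + (v₁ * (q₂ - p₂) + v₂ * (r₂ - p₂))) * c
  collect = solve-∀

-- Point reflections, height, and retractions at a chamber

infixl 6 _⊟_

_⊟_ : Pt → Pt → Pt
(v₁ , v₂) ⊟ (w₁ , w₂) = v₁ - w₁ , v₂ - w₂

⊟-O : ∀ v → v ⊟ O ≡ v
⊟-O (v₁ , v₂) = cong₂ _,_ (ℤ.+-identityʳ v₁) (ℤ.+-identityʳ v₂)

⊟-self : ∀ v → v ⊟ v ≡ O
⊟-self (v₁ , v₂) = cong₂ _,_ (ℤ.+-inverseʳ v₁) (ℤ.+-inverseʳ v₂)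

mirror-dist² : ∀ v x y → dist² (v ⊟ x) (v ⊟ y) ≡ dist² x y
mirror-dist² (v₁ , v₂) x@(x₁ , x₂) y@(y₁ , y₂) =
  trans (cong ∥_∥² (cong₂ _,_ (cancel v₁ x₁ y₁) (cancel v₂ x₂ y₂))) (dist²-sym y x)
  where
  cancel : ∀ v x y → (v - x) - (v - y) ≡ y - x
  cancel = solve-∀

mirror-triangle : ∀ v → Triangle (v ⊟ O) (v ⊟ E₁) (v ⊟ E₂)
mirror-triangle v = mirror-dist² v O E₁ , mirror-dist² v E₁ E₂ , mirror-dist² v O E₂

frame-mirror : ∀ v w → frame (v ⊟ O) (v ⊟ E₁) (v ⊟ E₂) w ≡ v ⊟ w
frame-mirror (v₁ , v₂) (w₁ , w₂) = cong₂ _,_ (first v₁ w₁ w₂) (second v₂ w₁ w₂)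
  where
  first : ∀ v x y → (v - + 0) + (x * ((v - + 1) - (v - + 0)) + y * ((v - + 0) - (v - + 0))) ≡ v - x
  first = solve-∀
  second : ∀ v x y → (v - + 0) + (x * ((v - + 0) - (v - + 0)) + y * ((v - + 1) - (v - + 0))) ≡ v - y
  second = solve-∀

height : Pt → ℤ
height (x , y) = x + y

height-step : ∀ v w → dist² v w ≡ + 1 → height v ℤ.≤ + 1 + height w
height-step (v₁ , v₂) (w₁ , w₂) unit = subst (ℤ._≤ + 1 + (w₁ + w₂)) (add v₁ v₂ w₁ w₂)
  (ℤ.+-monoˡ-≤ (w₁ + w₂) (unit-sum (v₁ - w₁) (v₂ - w₂) unit))
  where
  add : ∀ v₁ v₂ w₁ w₂ → (v₁ - w₁) + (v₂ - w₂) + (w₁ + w₂) ≡ v₁ + v₂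
  add = solve-∀

high-unit : ∀ w → dist² O w ≡ + 1 → + 1 ℤ.≤ height w → w ≡ E₁ ⊎ w ≡ E₂
high-unit w@(x , y) unit 1≤ =
  unit-sum-1 x y unit′ (ℤ.≤-antisym (unit-sum x y unit′) 1≤)
  where
  unit′ : ∥ x , y ∥² ≡ + 1
  unit′ = trans (cong ∥_∥² (sym (⊟-O w))) (trans (dist²-sym w O) unit)

module Retraction (𝓑 : Building) where
  open Building 𝓑
  open Charts 𝓑

  recorner : Chart → ∀ p q r → Triangle p q r → Chart
  recorner (mkChart α a b c abc) p q r pqr =
    mkChart α (frame a b c p) (frame a b c q) (frame a b c r) (frame-triangle a b c abc p q r pqr)

  ⟦recorner⟧ : ∀ φ p q r pqr v → ⟦ recorner φ p q r pqr ⟧ v ≡ ⟦ φ ⟧ (frame p q r v)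
  ⟦recorner⟧ (mkChart α a b c abc) p q r pqr v = cong (chart α) (frame-frame a b c p q r v)

  corner-chamber : ∀ φ → Chamber (⟦ φ ⟧ O) (⟦ φ ⟧ E₁) (⟦ φ ⟧ E₂)
  corner-chamber φ = ⟦⟧-chamber φ O E₁ E₂ (refl , refl , refl)

  chamber-adj₁₂ : ∀ {x y z} → Chamber x y z → Adj x y
  chamber-adj₁₂ xyz = _ , xyz

  chamber-adj₂₃ : ∀ {x y z} → Chamber x y z → Adj y z
  chamber-adj₂₃ xyz = _ , chamber-rotate xyz

  chamber-adj₁₃ : ∀ {x y z} → Chamber x y z → Adj x z
  chamber-adj₁₃ xyz = adj-sym (_ , chamber-rotate (chamber-rotate xyz))

  ⟦⟧-reflects-chamber : ∀ φ u v w → Chamber (⟦ φ ⟧ u) (⟦ φ ⟧ v) (⟦ φ ⟧ w) → Triangle u v w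
  ⟦⟧-reflects-chamber φ u v w uvw =
    ⟦⟧-reflects-adj φ u v (chamber-adj₁₂ uvw) , ⟦⟧-reflects-adj φ v w (chamber-adj₂₃ uvw) ,
    ⟦⟧-reflects-adj φ u w (chamber-adj₁₃ uvw)

  data Reach (x : Vertex) : ℕ → Vertex → Set where
    start : Reach x 0 x
    step  : ∀ {n y z} → Reach x n y → Adj y z → Reach x (suc n) z

  -- v is the image of x under the retraction onto the model apartment centred at
  -- the chamber {p, q, r}.
  Retracts : Vertex → Vertex → Vertex → Vertex → Pt → Set
  Retracts p q r x v = Σ[ ψ ∈ Chart ] Cornered ψ p q r × ⟦ ψ ⟧ v ≡ x

  -- Each edge of the walk is put in a chart of its own together with the central chamber. By
  -- `corner-rigid` consecutive charts give their shared vertex the same coordinates, so each step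
  -- of the walk retracts to a unit step.
  retract-reach : ∀ {p q r x n y} → Chamber p q r → ∀ v → Retracts p q r x v → Reach x n y →
                  ∃[ w ] Retracts p q r y w × height v ℤ.≤ + n + height w
  retract-reach pqr v ρ start = v , ρ , ℤ.≤-reflexive (sym (ℤ.+-identityˡ (height v)))
  retract-reach {n = suc n} pqr v ρ (step {y = y} {z} walk (t , yzt)) =
    let w , (ψ , ψ-corner , ψw≡y) , v≤ = retract-reach pqr v ρ walk
        χ , χ-corner , w₁ , w₂ , _ , χw₁≡y , χw₂≡z , _ = chart-to-chamber pqr yzt
        w≡w₁ = corner-rigid ψ χ ψ-corner χ-corner w w₁ (trans ψw≡y (sym χw₁≡y))
        unit = ⟦⟧-reflects-adj χ w₁ w₂ (subst₂ Adj (sym χw₁≡y) (sym χw₂≡z) (t , yzt))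
    in w₂ , (χ , χ-corner , χw₂≡z) ,
       ℤ.≤-trans v≤ (subst (+ n + height w ℤ.≤_) (add (+ n) (height w₂))
         (ℤ.+-monoʳ-≤ (+ n) (subst (λ w → height w ℤ.≤ + 1 + height w₂) {w₁} {w} (sym w≡w₁) (height-step w₁ w₂ unit))))
    where
    add : ∀ n h → n + (+ 1 + h) ≡ (+ 1 + n) + h
    add = solve-∀

  -- Retract from the triangle {v, v - E₁, v - E₂}, in the coordinates w ↦ v - w: along a walk
  -- the height drops by at most one per step, so y goes to a unit vector of positive height.
  closer-neighbour : ∀ φ v {n y} → height v ≡ + suc n → Adj (⟦ φ ⟧ v) y → Reach (⟦ φ ⟧ O) n y →
                     y ≡ ⟦ φ ⟧ (v ⊟ E₁) ⊎ y ≡ ⟦ φ ⟧ (v ⊟ E₂)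
  closer-neighbour φ v {n} {y} high adj walk =
    let w , (ψ , (ψO , ψE₁ , ψE₂) , ψw≡y) , v≤ = retract-reach (corner-chamber ξ) v
          (ξ , (refl , refl , refl) , trans (ξ≡ v) (cong ⟦ φ ⟧ (⊟-self v))) walk
        unit = ⟦⟧-reflects-adj ψ O w (subst₂ Adj (sym (trans ψO (trans (ξ≡ O) (cong ⟦ φ ⟧ (⊟-O v))))) (sym ψw≡y) adj)
        1≤ = cancel (+ n) (+ 1) (height w) (subst (ℤ._≤ + n + height w) (trans high (cong +_ (ℕ.+-comm 1 n))) v≤)
    in conclude ψ ψE₁ ψE₂ ψw≡y (high-unit w unit 1≤)
    where
    cancel : ∀ i j k → i + j ℤ.≤ i + k → j ℤ.≤ k
    cancel i j k le = subst₂ ℤ._≤_ (drop i j) (drop i k) (ℤ.+-monoʳ-≤ (ℤ.- i) le)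
      where
      drop : ∀ i j → ℤ.- i + (i + j) ≡ j
      drop = solve-∀
    ξ : Chart
    ξ = recorner φ (v ⊟ O) (v ⊟ E₁) (v ⊟ E₂) (mirror-triangle v)
    ξ≡ : ∀ w → ⟦ ξ ⟧ w ≡ ⟦ φ ⟧ (v ⊟ w)
    ξ≡ w = trans (⟦recorner⟧ φ (v ⊟ O) (v ⊟ E₁) (v ⊟ E₂) (mirror-triangle v) w) (cong ⟦ φ ⟧ (frame-mirror v w))
    conclude : ∀ ψ {w} → ⟦ ψ ⟧ E₁ ≡ ⟦ ξ ⟧ E₁ → ⟦ ψ ⟧ E₂ ≡ ⟦ ξ ⟧ E₂ → ⟦ ψ ⟧ w ≡ y → w ≡ E₁ ⊎ w ≡ E₂ →
               y ≡ ⟦ φ ⟧ (v ⊟ E₁) ⊎ y ≡ ⟦ φ ⟧ (v ⊟ E₂)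
    conclude ψ p₁ p₂ eq (inj₁ refl) = inj₁ (trans (sym eq) (trans p₁ (ξ≡ E₁)))
    conclude ψ p₁ p₂ eq (inj₂ refl) = inj₂ (trans (sym eq) (trans p₂ (ξ≡ E₂)))

descend : ∀ M (P : ∀ k → .(k ℕ.≤ M) → Set) → P M ℕ.≤-refl →
          (∀ k .(k<M : suc k ℕ.≤ M) .(k≤M : k ℕ.≤ M) → P (suc k) k<M → P k k≤M) →
          ∀ k (k≤M : k ℕ.≤ M) → P k k≤M
descend M P top down k k≤M = go (M ℕ.∸ k) k k≤M (ℕ.m∸n+n≡m k≤M)
  where
  go : ∀ d k .(k≤M : k ℕ.≤ M) → d ℕ.+ k ≡ M → P k k≤M
  go zero    k k≤M refl = top
  go (suc d) k k≤M eq   = down k sk≤M k≤M (go d (suc k) sk≤M eq′)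
    where
    eq′ = trans (ℕ.+-suc d k) eq
    sk≤M = subst (suc k ℕ.≤_) eq′ (ℕ.m≤n+m (suc k) d)

-- Convexity: parallelograms determined by a corner triangle and the far corner

module Parallelograms (𝓑 : Building) where
  open Building 𝓑
  open Charts 𝓑
  open Retraction 𝓑

  -- Edges alone are required of `f`, so that the same argument serves words, second charts, and
  -- translates of charts under the group.
  module Grid (M N : ℕ) (f : ∀ k l → .(k ℕ.≤ M) → .(l ℕ.≤ N) → Vertex)
    (horizontal : ∀ k l .(k<M : suc k ℕ.≤ M) .(k≤M : k ℕ.≤ M) .(l≤N : l ℕ.≤ N) →
                  Adj (f k l k≤M l≤N) (f (suc k) l k<M l≤N))
    (vertical : ∀ k l .(k≤M : k ℕ.≤ M) .(l<N : suc l ℕ.≤ N) .(l≤N : l ℕ.≤ N) →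
                Adj (f k l k≤M l≤N) (f k (suc l) k≤M l<N))
    (φ : Chart) (origin : f 0 0 ℕ.z≤n ℕ.z≤n ≡ ⟦ φ ⟧ O) where

    reach : ∀ k l .(k≤M : k ℕ.≤ M) .(l≤N : l ℕ.≤ N) → Reach (⟦ φ ⟧ O) (k ℕ.+ l) (f k l k≤M l≤N)
    reach zero    zero    k≤M l≤N = subst (λ x → Reach x 0 (f 0 0 ℕ.z≤n ℕ.z≤n)) origin start
    reach zero    (suc l) k≤M l<N = step (reach zero l k≤M (ℕ.<⇒≤ l<N)) (vertical zero l k≤M l<N (ℕ.<⇒≤ l<N))
    reach (suc k) l       k<M l≤N = step (reach k l (ℕ.<⇒≤ k<M) l≤N) (horizontal k l k<M (ℕ.<⇒≤ k<M) l≤N)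

    left : ∀ k l .(k<M : suc k ℕ.≤ M) .(k≤M : k ℕ.≤ M) .(l≤N : l ℕ.≤ N) →
      f (suc k) l k<M l≤N ≡ ⟦ φ ⟧ (+ suc k , + l) →
      f k l k≤M l≤N ≡ ⟦ φ ⟧ (+ k , + l) ⊎ f k l k≤M l≤N ≡ ⟦ φ ⟧ ((+ suc k , + l) ⊟ E₂)
    left k l k<M k≤M l≤N eq = simplify (closer-neighbour φ (+ suc k , + l) refl
        (subst (λ x → Adj x (f k l k≤M l≤N)) eq (adj-sym (horizontal k l k<M k≤M l≤N)))
        (reach k l k≤M l≤N))
      where
      simplify : f k l k≤M l≤N ≡ ⟦ φ ⟧ ((+ suc k , + l) ⊟ E₁) ⊎ f k l k≤M l≤N ≡ ⟦ φ ⟧ ((+ suc k , + l) ⊟ E₂) → _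
      simplify (inj₁ p) = inj₁ (trans p (cong (λ y → ⟦ φ ⟧ (+ k , y)) (ℤ.+-identityʳ (+ l))))
      simplify (inj₂ p) = inj₂ p

    below : ∀ k l .(k≤M : k ℕ.≤ M) .(l<N : suc l ℕ.≤ N) .(l≤N : l ℕ.≤ N) →
      f k (suc l) k≤M l<N ≡ ⟦ φ ⟧ (+ k , + suc l) →
      f k l k≤M l≤N ≡ ⟦ φ ⟧ ((+ k , + suc l) ⊟ E₁) ⊎ f k l k≤M l≤N ≡ ⟦ φ ⟧ (+ k , + l)
    below k l k≤M l<N l≤N eq = simplify (closer-neighbour φ (+ k , + suc l) (cong +_ (ℕ.+-suc k l))
        (subst (λ x → Adj x (f k l k≤M l≤N)) eq (adj-sym (vertical k l k≤M l<N l≤N)))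
        (reach k l k≤M l≤N))
      where
      simplify : f k l k≤M l≤N ≡ ⟦ φ ⟧ ((+ k , + suc l) ⊟ E₁) ⊎ f k l k≤M l≤N ≡ ⟦ φ ⟧ ((+ k , + suc l) ⊟ E₂) → _
      simplify (inj₁ p) = inj₁ p
      simplify (inj₂ p) = inj₂ (trans p (cong (λ x → ⟦ φ ⟧ (x , + l)) (ℤ.+-identityʳ (+ k))))

    -- The descent runs down the last column and then leftwards along each row. The unwanted
    -- candidate needs no refutation: `straight` equates its coordinates with the wanted ones, which
    -- converts one conclusion into the other.
    agree : (∀ k l .(k≤M : k ℕ.≤ M) .(l≤N : l ℕ.≤ N) v → f k l k≤M l≤N ≡ ⟦ φ ⟧ v → (+ k , + l) ≡ v) →
      f M N ℕ.≤-refl ℕ.≤-refl ≡ ⟦ φ ⟧ (+ M , + N) →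
      ∀ k l (k≤M : k ℕ.≤ M) (l≤N : l ℕ.≤ N) → f k l k≤M l≤N ≡ ⟦ φ ⟧ (+ k , + l)
    agree straight top k l k≤M l≤N =
      descend M (λ k k≤M → f k l k≤M l≤N ≡ ⟦ φ ⟧ (+ k , + l))
        (descend N (λ l l≤N → f M l ℕ.≤-refl l≤N ≡ ⟦ φ ⟧ (+ M , + l)) top
          (λ l l<N l≤N eq → either M l ℕ.≤-refl l≤N ((+ M , + suc l) ⊟ E₁) (swap (below M l ℕ.≤-refl l<N l≤N eq))) l l≤N)
        (λ k k<M k≤M eq → either k l k≤M l≤N ((+ suc k , + l) ⊟ E₂) (left k l k<M k≤M l≤N eq)) k k≤M
      where
      either : ∀ k l .(k≤M : k ℕ.≤ M) .(l≤N : l ℕ.≤ N) v →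
        f k l k≤M l≤N ≡ ⟦ φ ⟧ (+ k , + l) ⊎ f k l k≤M l≤N ≡ ⟦ φ ⟧ v → f k l k≤M l≤N ≡ ⟦ φ ⟧ (+ k , + l)
      either k l k≤M l≤N v (inj₁ p) = p
      either k l k≤M l≤N v (inj₂ p) = trans p (cong ⟦ φ ⟧ (sym (straight k l k≤M l≤N v p)))

  dist²-right : ∀ k y → dist² (+ k , y) (+ suc k , y) ≡ + 1
  dist²-right k y = trans (cong₂ (λ x x′ → dist² (+ k , x) (+ suc k , x′)) (sym (ℤ.+-identityˡ y)) (sym (ℤ.+-identityˡ y)))
    (⊞-dist² O E₁ (+ k , y))

  dist²-up : ∀ x l → dist² (x , + l) (x , + suc l) ≡ + 1
  dist²-up x l = trans (cong₂ (λ y y′ → dist² (y , + l) (y′ , + suc l)) (sym (ℤ.+-identityˡ x)) (sym (ℤ.+-identityˡ x)))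
    (⊞-dist² O E₂ (x , + l))

  -- A chart is itself a grid of edges, and `corner-rigid` supplies the hypothesis `straight` of
  -- `Grid.agree`.
  hull : ∀ φ ψ {x y z} → Cornered φ x y z → Cornered ψ x y z → ∀ M N →
    ⟦ ψ ⟧ (+ M , + N) ≡ ⟦ φ ⟧ (+ M , + N) →
    ∀ k l → k ℕ.≤ M → l ℕ.≤ N → ⟦ ψ ⟧ (+ k , + l) ≡ ⟦ φ ⟧ (+ k , + l)
  hull φ ψ cφ cψ M N top k l k≤M l≤N = Grid.agree M N (λ k l _ _ → ⟦ ψ ⟧ (+ k , + l))
    (λ k l _ _ _ → ⟦⟧-adj ψ (+ k , + l) (+ suc k , + l) (dist²-right k (+ l)))
    (λ k l _ _ _ → ⟦⟧-adj ψ (+ k , + l) (+ k , + suc l) (dist²-up (+ k) l))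
    φ (trans (proj₁ cψ) (sym (proj₁ cφ)))
    (λ k l _ _ v → corner-rigid ψ φ cψ cφ (+ k , + l) v) top k l k≤M l≤N

  -- The inequalities keep the triangles on s and z from being folded back onto the
  -- parallelogram.  The chart sought is one through the corner of φ and the last triangle.
  extend-chart : ∀ φ m n s z →
    Chamber (⟦ φ ⟧ (+ suc m , + n)) (⟦ φ ⟧ (+ suc m , + suc n)) s → s ≢ ⟦ φ ⟧ (+ m , + suc n) →
    Chamber (⟦ φ ⟧ (+ suc m , + suc n)) s z → z ≢ ⟦ φ ⟧ (+ suc m , + n) →
    Σ[ ψ ∈ Chart ] Cornered ψ (⟦ φ ⟧ O) (⟦ φ ⟧ E₁) (⟦ φ ⟧ E₂)
      × (∀ k l → k ℕ.≤ suc m → l ℕ.≤ suc n → ⟦ ψ ⟧ (+ k , + l) ≡ ⟦ φ ⟧ (+ k , + l))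
      × ⟦ ψ ⟧ (+ suc (suc m) , + n) ≡ s × ⟦ ψ ⟧ (+ suc (suc m) , + suc n) ≡ z
  extend-chart φ m n s z c₁ s≢ c₂ z≢ =
    let ψ , cψ , u , v , w , ψu , ψv , ψw = chart-to-chamber (corner-chamber φ) c₂
        -- The far corner of the parallelogram belongs to the second chamber, so both charts give it
        -- the same coordinates and `hull` applies. Then `third-vertex` locates `s` and afterwards
        -- `z`.
        same-top = corner-rigid ψ φ cψ (refl , refl , refl) u (+ suc m , + suc n) ψu
        agree = hull φ ψ (refl , refl , refl) cψ (suc m) (suc n) (trans (cong ⟦ ψ ⟧ (sym same-top)) ψu)
        v≡ = first ψ agree v ψv
        w≡ = second ψ agree w (trans (cong ⟦ ψ ⟧ (sym v≡)) ψv) ψw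
    in ψ , cψ , agree , trans (cong ⟦ ψ ⟧ (sym v≡)) ψv , trans (cong ⟦ ψ ⟧ (sym w≡)) ψw
    where
    V : Pt
    V = + m , + n
    Agree : Chart → Set
    Agree ψ = ∀ k l → k ℕ.≤ suc m → l ℕ.≤ suc n → ⟦ ψ ⟧ (+ k , + l) ≡ ⟦ φ ⟧ (+ k , + l)
    translate : ∀ x y z → Triangle x y z → Triangle (x ⊞ V) (y ⊞ V) (z ⊞ V)
    translate x y z (xy , yz , xz) = trans (⊞-dist² x y V) xy , trans (⊞-dist² y z V) yz , trans (⊞-dist² x z V) xz
    n≤ : n ℕ.≤ suc n
    n≤ = ℕ.n≤1+n n
    first : ∀ ψ → Agree ψ → ∀ v → ⟦ ψ ⟧ v ≡ s → v ≡ (+ suc (suc m) , + n)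
    first ψ agree v ψv = choose (third-vertex ((+ 1 , + 0) ⊞ V) ((+ 1 , + 1) ⊞ V) ((+ 0 , + 1) ⊞ V) v
        (translate (+ 1 , + 0) (+ 1 , + 1) (+ 0 , + 1) (refl , refl , refl))
        (⟦⟧-reflects-chamber ψ (+ suc m , + n) (+ suc m , + suc n) v
          (subst (λ s → Chamber _ _ s) (sym ψv)
            (subst₂ (λ x y → Chamber x y s) (sym (agree (suc m) n ℕ.≤-refl n≤)) (sym (agree (suc m) (suc n) ℕ.≤-refl ℕ.≤-refl)) c₁))))
      where
      choose : v ≡ (+ m , + suc n) ⊎ v ≡ opposite ((+ 1 , + 0) ⊞ V) ((+ 1 , + 1) ⊞ V) ((+ 0 , + 1) ⊞ V) →
               v ≡ (+ suc (suc m) , + n)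
      choose (inj₁ eq) = ⊥-elim (s≢ (trans (sym ψv) (trans (cong ⟦ ψ ⟧ eq) (agree m (suc n) (ℕ.n≤1+n m) ℕ.≤-refl))))
      choose (inj₂ eq) = trans eq (⊞-opposite (+ 1 , + 0) (+ 1 , + 1) (+ 0 , + 1) V)
    second : ∀ ψ → Agree ψ → ∀ w → ⟦ ψ ⟧ (+ suc (suc m) , + n) ≡ s → ⟦ ψ ⟧ w ≡ z → w ≡ (+ suc (suc m) , + suc n)
    second ψ agree w ψs ψw = choose (third-vertex ((+ 1 , + 1) ⊞ V) ((+ 2 , + 0) ⊞ V) ((+ 1 , + 0) ⊞ V) w
        (translate (+ 1 , + 1) (+ 2 , + 0) (+ 1 , + 0) (refl , refl , refl))
        (⟦⟧-reflects-chamber ψ (+ suc m , + suc n) (+ suc (suc m) , + n) w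
          (subst (λ z → Chamber _ _ z) (sym ψw)
            (subst₂ (λ x y → Chamber x y z) (sym (agree (suc m) (suc n) ℕ.≤-refl ℕ.≤-refl)) (sym ψs) c₂))))
      where
      choose : w ≡ (+ suc m , + n) ⊎ w ≡ opposite ((+ 1 , + 1) ⊞ V) ((+ 2 , + 0) ⊞ V) ((+ 1 , + 0) ⊞ V) →
               w ≡ (+ suc (suc m) , + suc n)
      choose (inj₁ eq) = ⊥-elim (z≢ (trans (sym ψw) (trans (cong ⟦ ψ ⟧ eq) (agree (suc m) n ℕ.≤-refl n≤))))
      choose (inj₂ eq) = trans eq (⊞-opposite (+ 1 , + 1) (+ 2 , + 0) (+ 1 , + 0) V)

  -- The neighbours of a vertex of the last column that are closer to the origin are its
  -- left and lower neighbours; the first is already taken.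
  fill : ∀ φ (f : Pt → Vertex) → (∀ v w → dist² v w ≡ + 1 → Adj (f v) (f w)) → ∀ m N →
    (∀ l → l ℕ.≤ N → ∀ k → k ℕ.≤ m → f (+ k , + l) ≡ ⟦ φ ⟧ (+ k , + l)) →
    f (+ suc m , + N) ≡ ⟦ φ ⟧ (+ suc m , + N) →
    ∀ l → l ℕ.≤ N → f (+ suc m , + l) ≡ ⟦ φ ⟧ (+ suc m , + l)
  fill φ f f-adj m N box top = descend N (λ l _ → f (+ suc m , + l) ≡ ⟦ φ ⟧ (+ suc m , + l)) top down
    where
    open Grid (suc m) N (λ k l _ _ → f (+ k , + l))
      (λ k l _ _ _ → f-adj (+ k , + l) (+ suc k , + l) (dist²-right k (+ l)))
      (λ k l _ _ _ → f-adj (+ k , + l) (+ k , + suc l) (dist²-up (+ k) l))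
      φ (box 0 ℕ.z≤n 0 ℕ.z≤n)
    down : ∀ l .(l<N : suc l ℕ.≤ N) .(l≤N : l ℕ.≤ N) → f (+ suc m , + suc l) ≡ ⟦ φ ⟧ (+ suc m , + suc l) →
           f (+ suc m , + l) ≡ ⟦ φ ⟧ (+ suc m , + l)
    down l l<N l≤N eq = choose (below (suc m) l ℕ.≤-refl l<N l≤N eq)
      where
      box′ : f (+ m , + suc l) ≡ ⟦ φ ⟧ (+ m , + suc l)
      box′ = box (suc l) (recompute (suc l ℕ.≤? N) l<N) m ℕ.≤-refl
      distinct : f (+ suc m , + l) ≢ f (+ m , + suc l)
      distinct eq = chamber-≢ (proj₂ (f-adj (+ suc m , + l) (+ m , + suc l) (⊞-dist² E₁ E₂ (+ m , + l)))) eq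
      choose : f (+ suc m , + l) ≡ ⟦ φ ⟧ ((+ suc m , + suc l) ⊟ E₁) ⊎ f (+ suc m , + l) ≡ ⟦ φ ⟧ (+ suc m , + l) →
               f (+ suc m , + l) ≡ ⟦ φ ⟧ (+ suc m , + l)
      choose (inj₁ p) = ⊥-elim (distinct (trans p
        (trans (cong (λ y → ⟦ φ ⟧ (+ m , y)) (ℤ.+-identityʳ (+ suc l))) (sym box′))))
      choose (inj₂ p) = p

-- Coordinates along and across the direction e i

crd : Fin 2 → ℕ → ℕ → ℕ × ℕ
crd Fin.zero           k l = k , l
crd (Fin.suc Fin.zero) k l = l , k

crd-coordinates : ∀ i m → ∃₂ λ M N → m ≡ crd i M N
crd-coordinates Fin.zero           (M , N) = M , N , refl
crd-coordinates (Fin.suc Fin.zero) (N , M) = M , N , refl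

crd-∈ : ∀ i {k l M N} → k ℕ.≤ suc M → l ℕ.≤ suc N → crd i k l ∈𝔭 crd i M N
crd-∈ Fin.zero           p q = p , q
crd-∈ (Fin.suc Fin.zero) p q = q , p

crd-∈⁺ : ∀ i {k l M N} → k ℕ.≤ suc (suc M) → l ℕ.≤ suc N → crd i k l ∈𝔭 crd i M N ⊕ e i
crd-∈⁺ Fin.zero           {k} {l} {M} {N} p q =
  subst (λ x → k ℕ.≤ suc x) (ℕ.+-comm 1 M) p , subst (λ x → l ℕ.≤ suc x) (sym (ℕ.+-identityʳ N)) q
crd-∈⁺ (Fin.suc Fin.zero) {k} {l} {M} {N} p q =
  subst (λ x → l ℕ.≤ suc x) (sym (ℕ.+-identityʳ N)) q , subst (λ x → k ℕ.≤ suc x) (ℕ.+-comm 1 M) p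

crd-cover : ∀ i {M N} l → l ∈𝔭 crd i M N →
            ∃₂ λ k k′ → k ℕ.≤ suc M × k′ ℕ.≤ suc N × l ≡ crd i k k′
crd-cover Fin.zero           (k , l) (p , q) = k , l , p , q , refl
crd-cover (Fin.suc Fin.zero) (l , k) (q , p) = k , l , p , q , refl

crd-cover⁺ : ∀ i {M N} l → l ∈𝔭 crd i M N ⊕ e i →
             l ∈𝔭 crd i M N ⊎ ∃[ k ] k ℕ.≤ suc N × l ≡ crd i (suc (suc M)) k
crd-cover⁺ Fin.zero {M} {N} (k , l) (p , q)
  with ℕ.m≤n⇒m<n∨m≡n (subst (λ x → k ℕ.≤ suc x) (ℕ.+-comm M 1) p) | subst (λ x → l ℕ.≤ suc x) (ℕ.+-identityʳ N) q
... | inj₁ k<   | q′ = inj₁ (ℕ.s≤s⁻¹ k< , q′)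
... | inj₂ refl | q′ = inj₂ (l , q′ , refl)
crd-cover⁺ (Fin.suc Fin.zero) {M} {N} (l , k) (q , p)
  with ℕ.m≤n⇒m<n∨m≡n (subst (λ x → k ℕ.≤ suc x) (ℕ.+-comm M 1) p) | subst (λ x → l ℕ.≤ suc x) (ℕ.+-identityʳ N) q
... | inj₁ k<   | q′ = inj₁ (q′ , ℕ.s≤s⁻¹ k<)
... | inj₂ refl | q′ = inj₂ (l , q′ , refl)

∈𝔭? : ∀ m l → Dec (l ∈𝔭 m)
∈𝔭? (m₁ , m₂) (l₁ , l₂) = (l₁ ℕ.≤? suc m₁) ×-dec (l₂ ℕ.≤? suc m₂)

-- `type` is affine, so its values on a frame follow from the corners with barycentric weights 1 -
-- v₁ - v₂, v₁, v₂. The constants `+ 1` and `-[1+ 0 ]` are the types of `E₁` and `E₂`.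
type-frame : ∀ T a b c v k → + 3 Signed.∣ T - type (frame a b c v) →
  + 3 Signed.∣ type a - k → + 3 Signed.∣ type b - (+ 1 + k) → + 3 Signed.∣ type c - (-[1+ 0 ] + k) →
  + 3 Signed.∣ T - (type v + k)
type-frame T (a₁ , a₂) (b₁ , b₂) (c₁ , c₂) (v₁ , v₂) k pT pa pb pc =
  subst (+ 3 Signed.∣_) (sym (combination T a₁ a₂ b₁ b₂ c₁ c₂ v₁ v₂ k))
    (∣m∣n⇒∣m+n pT (∣m∣n⇒∣m+n (∣n⇒∣m*n (+ 1 - v₁ - v₂) pa) (∣m∣n⇒∣m+n (∣n⇒∣m*n v₁ pb) (∣n⇒∣m*n v₂ pc))))
  where
  combination : ∀ T a₁ a₂ b₁ b₂ c₁ c₂ v₁ v₂ k →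
    T - ((v₁ - v₂) + k) ≡
    (T - ((a₁ + (v₁ * (b₁ - a₁) + v₂ * (c₁ - a₁))) - (a₂ + (v₁ * (b₂ - a₂) + v₂ * (c₂ - a₂)))))
    + ((+ 1 - v₁ - v₂) * ((a₁ - a₂) - k) + (v₁ * ((b₁ - b₂) - (+ 1 + k)) + v₂ * ((c₁ - c₂) - (-[1+ 0 ] + k))))
  combination = solve-∀

-- Prolonging charts in either direction, and the types along a chart

module Turning (𝓑 : Building) where
  open Building 𝓑
  open Charts 𝓑
  open Retraction 𝓑
  open Parallelograms 𝓑

  -- Exchanging the axes reduces the direction of `e₂` to that of `e₁`. The exchange negates `type`,
  -- so prolonged charts are turned back and their types are recovered from the initial triangle.
  turn : Fin 2 → Chart → Chart
  turn Fin.zero           φ = φ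
  turn (Fin.suc Fin.zero) φ = recorner φ O E₂ E₁ (refl , refl , refl)

  private
    swap-frame : ∀ x y → frame O E₂ E₁ (x , y) ≡ (y , x)
    swap-frame x y = cong₂ _,_ (first x y) (second x y)
      where
      first : ∀ x y → + 0 + (x * + 0 + y * + 1) ≡ y
      first = solve-∀
      second : ∀ x y → + 0 + (x * + 1 + y * + 0) ≡ x
      second = solve-∀

  turn-crd : ∀ i φ k l → ⟦ turn i φ ⟧ (+ k , + l) ≡ ⟦ φ ⟧ (point (crd i k l))
  turn-crd Fin.zero           φ k l = refl
  turn-crd (Fin.suc Fin.zero) φ k l =
    trans (⟦recorner⟧ φ O E₂ E₁ (refl , refl , refl) (+ k , + l)) (cong ⟦ φ ⟧ (swap-frame (+ k) (+ l)))

  turn-point : ∀ i φ k l → ⟦ turn i φ ⟧ (point (crd i k l)) ≡ ⟦ φ ⟧ (+ k , + l)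
  turn-point Fin.zero           φ k l = refl
  turn-point (Fin.suc Fin.zero) φ k l =
    trans (⟦recorner⟧ φ O E₂ E₁ (refl , refl , refl) (+ l , + k)) (cong ⟦ φ ⟧ (swap-frame (+ l) (+ k)))

  -- The triangles {b, c, s} and {c, s, z} continue the triangle {d, b, c} to a strip
  -- without folding.
  Step : Vertex → Vertex → Vertex → Vertex → Vertex → Set
  Step b c d s z = Chamber b c s × s ≢ d × Chamber c s z × z ≢ b

  prolong-chart : ∀ i φ M N s z →
    Step (⟦ φ ⟧ (point (crd i (suc M) N))) (⟦ φ ⟧ (point (crd i (suc M) (suc N))))
         (⟦ φ ⟧ (point (crd i M (suc N)))) s z →
    Σ[ ψ ∈ Chart ] (∀ l → l ∈𝔭 crd i M N → ⟦ ψ ⟧ (point l) ≡ ⟦ φ ⟧ (point l))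
      × ⟦ ψ ⟧ (point (crd i (suc (suc M)) N)) ≡ s × ⟦ ψ ⟧ (point (crd i (suc (suc M)) (suc N))) ≡ z
  prolong-chart i φ M N s z (c₁ , s≢ , c₂ , z≢) =
    let at = λ k l → sym (turn-crd i φ k l)
        ψ , _ , agree , ψs , ψz = extend-chart (turn i φ) M N s z
          (subst₂ (λ x y → Chamber x y s) (at (suc M) N) (at (suc M) (suc N)) c₁)
          (λ eq → s≢ (trans eq (sym (at M (suc N)))))
          (subst (λ x → Chamber x s z) (at (suc M) (suc N)) c₂)
          (λ eq → z≢ (trans eq (sym (at (suc M) N))))
    in turn i ψ , same ψ agree ,
       trans (turn-point i ψ (suc (suc M)) N) ψs , trans (turn-point i ψ (suc (suc M)) (suc N)) ψz
    where
    same : ∀ ψ → (∀ k l → k ℕ.≤ suc M → l ℕ.≤ suc N → ⟦ ψ ⟧ (+ k , + l) ≡ ⟦ turn i φ ⟧ (+ k , + l)) →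
           ∀ l → l ∈𝔭 crd i M N → ⟦ turn i ψ ⟧ (point l) ≡ ⟦ φ ⟧ (point l)
    same ψ agree l l∈ with crd-cover i l l∈
    ... | k , k′ , p , q , refl = trans (turn-point i ψ k k′) (trans (agree k k′ p q) (turn-crd i φ k k′))

  chart-step : ∀ i φ →
    Step (⟦ φ ⟧ (point (crd i 1 0))) (⟦ φ ⟧ (point (crd i 1 1))) (⟦ φ ⟧ (point (crd i 0 1)))
         (⟦ φ ⟧ (point (crd i 2 0))) (⟦ φ ⟧ (point (crd i 2 1)))
  chart-step i φ =
    ⟦⟧-chamber φ (point (crd i 1 0)) (point (crd i 1 1)) (point (crd i 2 0)) (first i) ,
    (λ eq → s≢d i (injective (point (crd i 2 0)) (point (crd i 0 1)) eq)) ,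
    ⟦⟧-chamber φ (point (crd i 1 1)) (point (crd i 2 0)) (point (crd i 2 1)) (second i) ,
    (λ eq → z≢b i (injective (point (crd i 2 1)) (point (crd i 1 0)) eq))
    where
    injective : ∀ v w → ⟦ φ ⟧ v ≡ ⟦ φ ⟧ w → v ≡ w
    injective = corner-rigid φ φ (refl , refl , refl) (refl , refl , refl)
    first : ∀ i → Triangle (point (crd i 1 0)) (point (crd i 1 1)) (point (crd i 2 0))
    first Fin.zero           = refl , refl , refl
    first (Fin.suc Fin.zero) = refl , refl , refl
    second : ∀ i → Triangle (point (crd i 1 1)) (point (crd i 2 0)) (point (crd i 2 1))
    second Fin.zero           = refl , refl , refl
    second (Fin.suc Fin.zero) = refl , refl , refl
    s≢d : ∀ i → point (crd i 2 0) ≢ point (crd i 0 1)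
    s≢d Fin.zero           ()
    s≢d (Fin.suc Fin.zero) ()
    z≢b : ∀ i → point (crd i 2 1) ≢ point (crd i 1 0)
    z≢b Fin.zero           ()
    z≢b (Fin.suc Fin.zero) ()

  fill-crd : ∀ i φ (f : Pt → Vertex) → (∀ v w → dist² v w ≡ + 1 → Adj (f v) (f w)) → ∀ M N →
    (∀ l → l ∈𝔭 crd i M N → f (point l) ≡ ⟦ φ ⟧ (point l)) →
    f (point (crd i (suc (suc M)) (suc N))) ≡ ⟦ φ ⟧ (point (crd i (suc (suc M)) (suc N))) →
    ∀ l → l ∈𝔭 crd i M N ⊕ e i → f (point l) ≡ ⟦ φ ⟧ (point l)
  fill-crd i φ f f-adj M N box top l l∈ with crd-cover⁺ i l l∈
  ... | inj₁ l∈ = box l l∈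
  ... | inj₂ (k , k≤ , refl) = trans (turned i (suc (suc M)) k)
        (trans (fill (turn i φ) (f ∘ flip i) (adj i) (suc M) (suc N)
          (λ l l≤ k k≤ → trans (sym (turned i k l)) (trans (box (crd i k l) (crd-∈ i k≤ l≤)) (sym (turn-crd i φ k l))))
          (trans (sym (turned i (suc (suc M)) (suc N))) (trans top (sym (turn-crd i φ (suc (suc M)) (suc N)))))
          k k≤) (turn-crd i φ (suc (suc M)) k))
    where
    flip : Fin 2 → Pt → Pt
    flip Fin.zero           v       = v
    flip (Fin.suc Fin.zero) (x , y) = y , x
    turned : ∀ i k l → f (point (crd i k l)) ≡ f (flip i (+ k , + l))
    turned Fin.zero           k l = refl
    turned (Fin.suc Fin.zero) k l = refl
    flip-dist² : ∀ x y x′ y′ →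
      (y - y′) * (y - y′) + (y - y′) * (x - x′) + (x - x′) * (x - x′) ≡
      (x - x′) * (x - x′) + (x - x′) * (y - y′) + (y - y′) * (y - y′)
    flip-dist² = solve-∀
    adj : ∀ i v w → dist² v w ≡ + 1 → Adj (f (flip i v)) (f (flip i w))
    adj Fin.zero           v w unit = f-adj v w unit
    adj (Fin.suc Fin.zero) v@(x , y) w@(x′ , y′) unit =
      f-adj (y , x) (y′ , x′) (trans (flip-dist² x y x′ y′) unit)

  Rotating : Chart → Set
  Rotating φ = ∃[ k ] ∀ v → + toℕ (τ (⟦ φ ⟧ v)) ≡₃ type v + k

  -- `chart-type` speaks in the apartment's own coordinates; `type-frame` carries it to the
  -- coordinates of the marked triangle, whose three corners fix the shift.
  corner-rotating : ∀ φ k → + toℕ (τ (⟦ φ ⟧ O)) ≡₃ type O + k → + toℕ (τ (⟦ φ ⟧ E₁)) ≡₃ type E₁ + k →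
                    + toℕ (τ (⟦ φ ⟧ E₂)) ≡₃ type E₂ + k → Rotating φ
  corner-rotating φ@(mkChart α a b c abc) k pO p₁ p₂ = k , λ v →
    ∣⇒∣ᵤ (type-frame (+ toℕ (τ (⟦ φ ⟧ v))) a b c v k (∣ᵤ⇒∣ (chart-type α (frame a b c v)))
      (corner a O (frame-O a b c) (+ 0 + k) k (ℤ.+-identityˡ k) pO)
      (corner b E₁ (frame-E₁ a b c) (+ 1 + k) (+ 1 + k) refl p₁)
      (corner c E₂ (frame-E₂ a b c) (-[1+ 0 ] + k) (-[1+ 0 ] + k) refl p₂))
    where
    difference : ∀ a j T → a - j ≡ (T - j) + (-[1+ 0 ] * (T - a))
    difference = solve-∀
    corner : ∀ p v → frame a b c v ≡ p → ∀ j j′ → j ≡ j′ → + toℕ (τ (⟦ φ ⟧ v)) ≡₃ j → + 3 Signed.∣ type p - j′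
    corner p v refl j j′ refl eq = subst (+ 3 Signed.∣_)
      (sym (difference (type (frame a b c v)) j (+ toℕ (τ (⟦ φ ⟧ v)))))
      (∣m∣n⇒∣m+n (∣ᵤ⇒∣ {+ 3} {+ toℕ (τ (⟦ φ ⟧ v)) - j} eq) (∣n⇒∣m*n -[1+ 0 ]
        (∣ᵤ⇒∣ {+ 3} {+ toℕ (τ (⟦ φ ⟧ v)) - type (frame a b c v)} (chart-type α (frame a b c v)))))

crd-⊕ : ∀ i M N k l → crd i M N ⊕ crd i k l ≡ crd i (k ℕ.+ M) (l ℕ.+ N)
crd-⊕ Fin.zero           M N k l = cong₂ _,_ (ℕ.+-comm M k) (ℕ.+-comm N l)
crd-⊕ (Fin.suc Fin.zero) M N k l = cong₂ _,_ (ℕ.+-comm N l) (ℕ.+-comm M k)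

edge-∈ : ∀ i {k l} → k ℕ.≤ 2 → l ℕ.≤ 1 → crd i k l ∈𝔭 e i
edge-∈ Fin.zero           p q = p , q
edge-∈ (Fin.suc Fin.zero) p q = q , p

tile-∈ : ∀ i {k l} → k ℕ.≤ 1 → l ℕ.≤ 1 → crd i k l ∈𝔭 𝟘
tile-∈ Fin.zero           p q = p , q
tile-∈ (Fin.suc Fin.zero) p q = q , p

-- Once a successor's initial tile is matched with `t u`, the two vertices beyond that tile are all
-- that remains to be chosen.
edge-cover : ∀ i l → l ∈𝔭 e i → l ∈𝔭 𝟘 ⊎ (l ≡ crd i 2 0 ⊎ l ≡ crd i 2 1)
edge-cover Fin.zero           (0 , l) (p , q) = inj₁ (ℕ.z≤n , q)
edge-cover Fin.zero           (1 , l) (p , q) = inj₁ (ℕ.s≤s ℕ.z≤n , q)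
edge-cover Fin.zero           (2 , 0) (p , q) = inj₂ (inj₁ refl)
edge-cover Fin.zero           (2 , 1) (p , q) = inj₂ (inj₂ refl)
edge-cover Fin.zero           (2 , suc (suc l)) (p , ℕ.s≤s ())
edge-cover Fin.zero           (suc (suc (suc k)) , l) (ℕ.s≤s (ℕ.s≤s ()) , q)
edge-cover (Fin.suc Fin.zero) (l , 0) (q , p) = inj₁ (q , ℕ.z≤n)
edge-cover (Fin.suc Fin.zero) (l , 1) (q , p) = inj₁ (q , ℕ.s≤s ℕ.z≤n)
edge-cover (Fin.suc Fin.zero) (0 , 2) (q , p) = inj₂ (inj₁ refl)
edge-cover (Fin.suc Fin.zero) (1 , 2) (q , p) = inj₂ (inj₂ refl)
edge-cover (Fin.suc Fin.zero) (suc (suc l) , 2) (ℕ.s≤s () , p)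
edge-cover (Fin.suc Fin.zero) (l , suc (suc (suc k))) (q , ℕ.s≤s (ℕ.s≤s ()))

translate-∈ : ∀ i M N l → l ∈𝔭 𝟘 → crd i M N ⊕ l ∈𝔭 crd i M N
translate-∈ i M N (k , l) (p , q) = bound (proj₁ (crd i M N)) p , bound (proj₂ (crd i M N)) q
  where
  bound : ∀ m {k} → k ℕ.≤ 1 → m ℕ.+ k ℕ.≤ suc m
  bound m k≤1 = ℕ.≤-trans (ℕ.+-monoʳ-≤ m k≤1) (ℕ.≤-reflexive (ℕ.+-comm m 1))

-- Words as restrictions of charts, and the free action

module WordCharts (𝓑 : Building) {Γ : Group 0ℓ 0ℓ} (action : TypeRotatingAction 𝓑 Γ) where
  open Building 𝓑
  open Charts 𝓑
  open Retraction 𝓑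
  open Parallelograms 𝓑
  open Turning 𝓑
  open Words 𝓑 action
  open TypeRotatingAction action
  open Group Γ using (_∙_; _⁻¹; ε; inverseˡ; inverseʳ)

  -- The first three vertices form a chamber by `flag`. A chart through it and the far corner
  -- `(suc m₁ , suc m₂)` agrees with `u` on the whole grid, because `located` settles every choice
  -- in `Grid.agree`.
  chart-of : ∀ {m} (u : 𝔅 m) →
    Σ[ φ ∈ Chart ] Rotating φ × (∀ l .(l∈ : l ∈𝔭 m) → at u l l∈ ≡ ⟦ φ ⟧ (point l))
  chart-of {m@(m₁ , m₂)} u =
    let φ , (pO , p₁ , p₂) , v , pv = chart-to-vertex corner (at u (suc m₁ , suc m₂) top∈)
        locate = λ l .(l∈ : l ∈𝔭 m) w eq → located φ pO p₁ p₂ l l∈ w eq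
        agree = Grid.agree (suc m₁) (suc m₂) (λ k l p q → at u (k , l) (p , q))
          (λ k l k<M k≤M l≤N → adj (k , l) (suc k , l) (k≤M , l≤N) (k<M , l≤N) (dist²-right k (+ l)))
          (λ k l k≤M l<N l≤N → adj (k , l) (k , suc l) (k≤M , l≤N) (k≤M , l<N) (dist²-up (+ k) l))
          φ (sym pO) (λ k l k≤M l≤N w eq → locate (k , l) (k≤M , l≤N) w eq)
          (trans (sym pv) (cong ⟦ φ ⟧ (sym (locate (suc m₁ , suc m₂) top∈ v (sym pv)))))
        c , h = rotating u
    in φ , corner-rotating φ c (typed (0 , 0) O∈ pO c (h (0 , 0) O∈)) (typed (1 , 0) E₁∈ p₁ c (h (1 , 0) E₁∈))
             (typed (0 , 1) E₂∈ p₂ c (h (0 , 1) E₂∈)) ,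
       (λ { (k , l) l∈ → let p , q = recompute (∈𝔭? m (k , l)) l∈ in agree k l p q })
    where
    O∈ : (0 , 0) ∈𝔭 m
    O∈ = ℕ.z≤n , ℕ.z≤n
    E₁∈ : (1 , 0) ∈𝔭 m
    E₁∈ = ℕ.s≤s ℕ.z≤n , ℕ.z≤n
    E₂∈ : (0 , 1) ∈𝔭 m
    E₂∈ = ℕ.z≤n , ℕ.s≤s ℕ.z≤n
    top∈ : (suc m₁ , suc m₂) ∈𝔭 m
    top∈ = ℕ.≤-refl , ℕ.≤-refl
    adj : ∀ l l′ .(l∈ : l ∈𝔭 m) .(l′∈ : l′ ∈𝔭 m) → dist² (point l) (point l′) ≡ + 1 → Adj (at u l l∈) (at u l′ l′∈)
    adj l l′ l∈ l′∈ unit = Dist²-adj (subst (Dist² 𝓑 (at u l l∈) (at u l′ l′∈)) unit (isometric u l l′ l∈ l′∈))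
    corner : Chamber (at u (0 , 0) O∈) (at u (1 , 0) E₁∈) (at u (0 , 1) E₂∈)
    corner = flag (adj (0 , 0) (1 , 0) O∈ E₁∈ refl) (adj (1 , 0) (0 , 1) E₁∈ E₂∈ refl) (adj (0 , 0) (0 , 1) O∈ E₂∈ refl)
    -- Distances to the three corners determine a point, so u cannot be folded along its chart.
    located : ∀ φ → ⟦ φ ⟧ O ≡ at u (0 , 0) O∈ → ⟦ φ ⟧ E₁ ≡ at u (1 , 0) E₁∈ → ⟦ φ ⟧ E₂ ≡ at u (0 , 1) E₂∈ →
              ∀ l .(l∈ : l ∈𝔭 m) w → at u l l∈ ≡ ⟦ φ ⟧ w → point l ≡ w
    located φ pO p₁ p₂ l l∈ w eq = trilateration (point l) w (same (0 , 0) O∈ pO) (same (1 , 0) E₁∈ p₁) (same (0 , 1) E₂∈ p₂)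
      where
      same : ∀ l′ .(l′∈ : l′ ∈𝔭 m) → ⟦ φ ⟧ (point l′) ≡ at u l′ l′∈ → dist² (point l) (point l′) ≡ dist² w (point l′)
      same l′ l′∈ eq′ = Dist²-unique (isometric u l l′ l∈ l′∈)
        (subst₂ (λ x y → Dist² 𝓑 x y (dist² w (point l′))) (sym eq) eq′ (⟦⟧-dist² φ w (point l′)))
    typed : ∀ l .(l∈ : l ∈𝔭 m) {x} → x ≡ at u l l∈ → ∀ c → + toℕ (τ (at u l l∈)) ≡₃ type (point l) + c →
            + toℕ (τ x) ≡₃ type (point l) + c
    typed l l∈ refl c h = h

  word-of : ∀ φ → Rotating φ → ∀ m → 𝔅 m
  word-of φ (c , h) m = record
    { at        = λ l _ → ⟦ φ ⟧ (point l)
    ; isometric = λ l l′ _ _ → ⟦⟧-dist² φ (point l) (point l′)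
    ; rotating  = c , λ l _ → h (point l)
    }

  prolong-rotating : ∀ φ ψ → Rotating φ → ∀ m → (∀ l → l ∈𝔭 m → ⟦ ψ ⟧ (point l) ≡ ⟦ φ ⟧ (point l)) → Rotating ψ
  prolong-rotating φ ψ (c , h) m agree = corner-rotating ψ c
    (typed (0 , 0) (ℕ.z≤n , ℕ.z≤n)) (typed (1 , 0) (ℕ.s≤s ℕ.z≤n , ℕ.z≤n)) (typed (0 , 1) (ℕ.z≤n , ℕ.s≤s ℕ.z≤n))
    where
    typed : ∀ l → l ∈𝔭 m → + toℕ (τ (⟦ ψ ⟧ (point l))) ≡₃ type (point l) + c
    typed l l∈ = subst (λ x → + toℕ (τ x) ≡₃ type (point l) + c) (sym (agree l l∈)) (h (point l))

  Step-cong : ∀ {b b′ c c′ d d′ s s′ z z′} → b ≡ b′ → c ≡ c′ → d ≡ d′ → s ≡ s′ → z ≡ z′ →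
              Step b c d s z → Step b′ c′ d′ s′ z′
  Step-cong refl refl refl refl refl st = st

  ▷-injective : ∀ γ {x y} → γ ▷ x ≡ γ ▷ y → x ≡ y
  ▷-injective γ {x} {y} eq = trans (sym (undo x)) (trans (cong (γ ⁻¹ ▷_) eq) (undo y))
    where
    undo : ∀ x → γ ⁻¹ ▷ γ ▷ x ≡ x
    undo x = trans (sym (▷-composite (γ ⁻¹) γ x)) (trans (▷-cong (inverseˡ γ) x) (▷-identity x))

  Step-▷ : ∀ γ {b c d s z} → Step b c d s z → Step (γ ▷ b) (γ ▷ c) (γ ▷ d) (γ ▷ s) (γ ▷ z)
  Step-▷ γ (c₁ , s≢ , c₂ , z≢) =
    ▷-chamber γ c₁ , (λ eq → s≢ (▷-injective γ eq)) , ▷-chamber γ c₂ , (λ eq → z≢ (▷-injective γ eq))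

  -- `h ⁻¹ ∙ g` fixes `y`, so freeness makes it trivial.
  free-agree : FreeOnVertices → ∀ g h {y} → g ▷ y ≡ h ▷ y → ∀ x → g ▷ x ≡ h ▷ x
  free-agree free g h {y} eq x =
    trans (sym (▷-identity (g ▷ x)))
    (trans (sym (▷-cong (inverseʳ h) (g ▷ x)))
    (trans (▷-composite h (h ⁻¹) (g ▷ x))
    (cong (h ▷_) (trans (sym (▷-composite (h ⁻¹) g x))
      (trans (▷-cong (free (h ⁻¹ ∙ g) y fixed) x) (▷-identity x))))))
    where
    fixed : (h ⁻¹ ∙ g) ▷ y ≡ y
    fixed = trans (▷-composite (h ⁻¹) g y) (trans (cong (h ⁻¹ ▷_) eq)
      (trans (sym (▷-composite (h ⁻¹) h y)) (trans (▷-cong (inverseˡ h) y) (▷-identity y))))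

  word-step : ∀ i (w : 𝔅 (e i)) →
    Step (at w (crd i 1 0) (edge-∈ i (ℕ.s≤s ℕ.z≤n) ℕ.z≤n)) (at w (crd i 1 1) (edge-∈ i (ℕ.s≤s ℕ.z≤n) ℕ.≤-refl))
         (at w (crd i 0 1) (edge-∈ i ℕ.z≤n ℕ.≤-refl))
         (at w (crd i 2 0) (edge-∈ i ℕ.≤-refl ℕ.z≤n)) (at w (crd i 2 1) (edge-∈ i ℕ.≤-refl ℕ.≤-refl))
  word-step i w =
    let ω , _ , h = chart-of w
    in Step-cong (sym (h (crd i 1 0) (edge-∈ i (ℕ.s≤s ℕ.z≤n) ℕ.z≤n)))
         (sym (h (crd i 1 1) (edge-∈ i (ℕ.s≤s ℕ.z≤n) ℕ.≤-refl))) (sym (h (crd i 0 1) (edge-∈ i ℕ.z≤n ℕ.≤-refl)))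
         (sym (h (crd i 2 0) (edge-∈ i ℕ.≤-refl ℕ.z≤n))) (sym (h (crd i 2 1) (edge-∈ i ℕ.≤-refl ℕ.≤-refl)))
         (chart-step i ω)

-- Existence and uniqueness of products

module Products (𝓑 : Building) {Γ : Group 0ℓ 0ℓ} (action : TypeRotatingAction 𝓑 Γ)
                (free : TypeRotatingAction.FreeOnVertices action) where
  open Building 𝓑
  open Charts 𝓑
  open Turning 𝓑
  open Words 𝓑 action
  open WordCharts 𝓑 action
  open TypeRotatingAction action
  open Group Γ using (_∙_; ε)

  private
    1≤2 : 1 ℕ.≤ 2
    1≤2 = ℕ.s≤s ℕ.z≤n

  module _ (i : Fin 2) (M N : ℕ) (u : 𝔅 (crd i M N)) where
    private
      m = crd i M N

      lift-∈ : ∀ {l} → l ∈𝔭 m → l ∈𝔭 m ⊕ e i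
      lift-∈ (p , q) = ℕ.≤-trans p (ℕ.s≤s (ℕ.m≤m+n _ _)) , ℕ.≤-trans q (ℕ.s≤s (ℕ.m≤m+n _ _))

      shift-∈ : ∀ l → l ∈𝔭 e i → m ⊕ l ∈𝔭 m ⊕ e i
      shift-∈ (k , l) (p , q) = bound (proj₁ m) p , bound (proj₂ m) q
        where
        bound : ∀ a {k b} → k ℕ.≤ suc b → a ℕ.+ k ℕ.≤ suc (a ℕ.+ b)
        bound a p = ℕ.≤-trans (ℕ.+-monoʳ-≤ a p) (ℕ.≤-reflexive (ℕ.+-suc a _))

    module _ (w : 𝔅 (e i)) (ow∼tu : o w ∼ t u) where
      private
        γ = proj₁ ow∼tu
        φ = proj₁ (chart-of u)
        u≡φ = proj₂ (proj₂ (chart-of u))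

        shared : ∀ l .(l∈ : l ∈𝔭 𝟘) .(l∈w : l ∈𝔭 e i) → γ ▷ at w l l∈w ≡ ⟦ φ ⟧ (point (m ⊕ l))
        shared l l∈ l∈w = trans (proj₂ ow∼tu l l∈)
          (u≡φ (m ⊕ l) (translate-∈ i M N l (recompute (∈𝔭? 𝟘 l) l∈)))

        shared-crd : ∀ k l → k ℕ.≤ 1 → l ℕ.≤ 1 → .(kl∈ : crd i k l ∈𝔭 e i) →
                      γ ▷ at w (crd i k l) kl∈ ≡ ⟦ φ ⟧ (point (crd i (k ℕ.+ M) (l ℕ.+ N)))
        shared-crd k l p q kl∈ = trans (shared (crd i k l) (tile-∈ i p q) kl∈)
          (cong (⟦ φ ⟧ ∘ point) (crd-⊕ i M N k l))

        -- After translation by `γ` the initial tile of `w` is the terminal tile of `u`; these are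
        -- the two vertices it adds. They do not fold back because `w` is isometric, as recorded in
        -- `word-step`.
        s = γ ▷ at w (crd i 2 0) (edge-∈ i ℕ.≤-refl ℕ.z≤n)
        z = γ ▷ at w (crd i 2 1) (edge-∈ i ℕ.≤-refl ℕ.≤-refl)

        prolonged = prolong-chart i φ M N s z (Step-cong
          (shared-crd 1 0 ℕ.≤-refl ℕ.z≤n (edge-∈ i 1≤2 ℕ.z≤n))
          (shared-crd 1 1 ℕ.≤-refl ℕ.≤-refl (edge-∈ i 1≤2 ℕ.≤-refl))
          (shared-crd 0 1 ℕ.z≤n ℕ.≤-refl (edge-∈ i ℕ.z≤n ℕ.≤-refl))
          refl refl (Step-▷ γ (word-step i w)))

        ψ = proj₁ prolonged
        ψ≡φ : ∀ l → l ∈𝔭 m → ⟦ ψ ⟧ (point l) ≡ ⟦ φ ⟧ (point l)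
        ψ≡φ = proj₁ (proj₂ prolonged)
        ψ-rotating = prolong-rotating φ ψ (proj₁ (proj₂ (chart-of u))) m ψ≡φ

      product-word : 𝔅 (m ⊕ e i)
      product-word = word-of ψ ψ-rotating (m ⊕ e i)

      private
        product-initial : ∀ l .(l∈ : l ∈𝔭 m) → ⟦ ψ ⟧ (point l) ≡ at u l l∈
        product-initial l l∈ = trans (ψ≡φ l (recompute (∈𝔭? m l) l∈)) (sym (u≡φ l l∈))

        product-terminal : ∀ l .(l∈ : l ∈𝔭 e i) → γ ▷ at w l l∈ ≡ ⟦ ψ ⟧ (point (m ⊕ l))
        product-terminal l l∈ = cases (edge-cover i l (recompute (∈𝔭? (e i) l) l∈))
          where
          cases : l ∈𝔭 𝟘 ⊎ (l ≡ crd i 2 0 ⊎ l ≡ crd i 2 1) → γ ▷ at w l l∈ ≡ ⟦ ψ ⟧ (point (m ⊕ l))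
          cases (inj₁ l∈𝟘) = trans (shared l l∈𝟘 l∈) (sym (ψ≡φ (m ⊕ l) (translate-∈ i M N l l∈𝟘)))
          cases (inj₂ (inj₁ refl)) = trans (sym (proj₁ (proj₂ (proj₂ prolonged))))
            (cong (⟦ ψ ⟧ ∘ point) (sym (crd-⊕ i M N 2 0)))
          cases (inj₂ (inj₂ refl)) = trans (sym (proj₂ (proj₂ (proj₂ prolonged))))
            (cong (⟦ ψ ⟧ ∘ point) (sym (crd-⊕ i M N 2 1)))

        is-product : IsProduct {m} {i} u w product-word
        is-product = product-word , Setoid.refl (W (m ⊕ e i)) {product-word} ,
          (ε , λ l l∈ → trans (▷-identity _) (product-initial l l∈)) ,
          Setoid.sym (W (e i)) {w} {window m (e i) (ℕ.≤-refl , ℕ.≤-refl) product-word}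
            (γ , product-terminal)

        -- Move the competitor `p` by `γ₁` so that it restricts to `u`. At a vertex of the shared
        -- tile `γ₁` acts as `γ ∙ γ₂`, hence everywhere by freeness, so the moved `p` also has the
        -- top vertex of the new column; `fill-crd` determines the rest of the column.
        unique : ∀ {v} → IsProduct {m} {i} u w v → product-word ∼ v
        unique {v} (p , p∼v , (γ₁ , restricts-u) , (γ₂ , restricts-w)) =
          Setoid.trans (W (m ⊕ e i)) {product-word} {p} {v}
            (Setoid.sym (W (m ⊕ e i)) {p} {product-word} (γ₁ , agree)) p∼v
          where
          π = proj₁ (chart-of p)
          p≡π = proj₂ (proj₂ (chart-of p))
          O∈e : (0 , 0) ∈𝔭 e i
          O∈e = ℕ.z≤n , ℕ.z≤n
          base : γ₁ ▷ at p (m ⊕ (0 , 0)) (shift-∈ (0 , 0) O∈e) ≡ (γ ∙ γ₂) ▷ at p (m ⊕ (0 , 0)) (shift-∈ (0 , 0) O∈e)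
          base = trans (restricts-u (m ⊕ (0 , 0)) (translate-∈ i M N (0 , 0) (ℕ.z≤n , ℕ.z≤n)))
            (trans (sym (proj₂ ow∼tu (0 , 0) (ℕ.z≤n , ℕ.z≤n)))
            (trans (cong (γ ▷_) (sym (restricts-w (0 , 0) O∈e))) (sym (▷-composite γ γ₂ _))))
          last : γ₁ ▷ at p (m ⊕ crd i 2 1) (shift-∈ (crd i 2 1) (edge-∈ i ℕ.≤-refl ℕ.≤-refl)) ≡ ⟦ ψ ⟧ (point (m ⊕ crd i 2 1))
          last = trans (free-agree free γ₁ (γ ∙ γ₂) base _)
            (trans (▷-composite γ γ₂ _)
            (trans (cong (γ ▷_) (restricts-w (crd i 2 1) (edge-∈ i ℕ.≤-refl ℕ.≤-refl)))
                   (product-terminal (crd i 2 1) (edge-∈ i ℕ.≤-refl ℕ.≤-refl))))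
          -- The action is assumed to preserve chambers, not the system of apartments, so a
          -- translated chart is treated only as a map that preserves edges.
          f : Pt → Vertex
          f v = γ₁ ▷ ⟦ π ⟧ v
          f-adj : ∀ v w → dist² v w ≡ + 1 → Adj (f v) (f w)
          f-adj v w unit = let x , c = ⟦⟧-adj π v w unit in γ₁ ▷ x , ▷-chamber γ₁ c
          box : ∀ l → l ∈𝔭 m → f (point l) ≡ ⟦ ψ ⟧ (point l)
          box l l∈ = trans (cong (γ₁ ▷_) (sym (p≡π l (lift-∈ l∈))))
            (trans (restricts-u l l∈) (sym (product-initial l l∈)))
          top : f (point (m ⊕ crd i 2 1)) ≡ ⟦ ψ ⟧ (point (m ⊕ crd i 2 1))
          top = trans (cong (γ₁ ▷_) (sym (p≡π (m ⊕ crd i 2 1) (shift-∈ (crd i 2 1) (edge-∈ i ℕ.≤-refl ℕ.≤-refl))))) last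
          agree : ∀ l .(l∈ : l ∈𝔭 m ⊕ e i) → γ₁ ▷ at p l l∈ ≡ ⟦ ψ ⟧ (point l)
          agree l l∈ = trans (cong (γ₁ ▷_) (p≡π l l∈))
            (fill-crd i ψ f f-adj M N box
              (subst (λ l → f (point l) ≡ ⟦ ψ ⟧ (point l)) (crd-⊕ i M N 2 1) top)
              l (recompute (∈𝔭? (m ⊕ e i) l) l∈))

      product : ∃! _∼_ (IsProduct {m} {i} u w)
      product = product-word , is-product , λ {v} → unique {v}

-- Counting the successors of a word

exactly-others : ∀ 𝓑 {q P d} → HasExactly 𝓑 (suc q) P → P d → HasExactly 𝓑 q (λ z → P z × z ≢ d)
exactly-others 𝓑 {q} {P} {d} (f , injective , satisfies , exhausts) Pd =
  f ∘ punchIn j ,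
  (λ eq → punchIn-injective j _ _ (injective eq)) ,
  (λ k → satisfies (punchIn j k) , λ eq → punchInᵢ≢i j k (injective (trans eq (sym fj≡d)))) ,
  λ { z (Pz , z≢d) → exhaust z z≢d (exhausts z Pz) }
  where
  j = proj₁ (exhausts d Pd)
  fj≡d = proj₂ (exhausts d Pd)
  exhaust : ∀ z → z ≢ d → ∃[ k ] f k ≡ z → ∃[ k ] f (punchIn j k) ≡ z
  exhaust z z≢d (k , fk≡z) = punchOut j≢k , trans (cong f (punchIn-punchOut j≢k)) fk≡z
    where
    j≢k : j ≢ k
    j≢k j≡k = z≢d (trans (sym fk≡z) (trans (cong f (sym j≡k)) fj≡d))

module Successors (𝓑 : Building) {Γ : Group 0ℓ 0ℓ} (action : TypeRotatingAction 𝓑 Γ)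
                  (free : TypeRotatingAction.FreeOnVertices action)
                  {q : ℕ} (order : OfOrder 𝓑 q) where
  open Building 𝓑
  open Charts 𝓑
  open Retraction 𝓑
  open Turning 𝓑
  open Words 𝓑 action
  open WordCharts 𝓑 action
  open TypeRotatingAction action
  open Group Γ using (ε)

  module _ (i : Fin 2) {m : Shape} (u : 𝔅 m) where
    private
      a = t u
      θ = proj₁ (chart-of a)
      a≡θ = proj₂ (proj₂ (chart-of a))

      corner : ℕ → ℕ → Vertex
      corner k l = ⟦ θ ⟧ (point (crd i k l))

      b = corner 1 0
      c = corner 1 1
      d = corner 0 1

      bcd : Chamber b c d
      bcd = ⟦⟧-chamber θ (point (crd i 1 0)) (point (crd i 1 1)) (point (crd i 0 1)) (upper i)
        where
        upper : ∀ i → Triangle (point (crd i 1 0)) (point (crd i 1 1)) (point (crd i 0 1))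
        upper Fin.zero           = refl , refl , refl
        upper (Fin.suc Fin.zero) = refl , refl , refl

      -- Of the q + 1 chambers on the edge `b c`, the one with third vertex `d` would fold the strip
      -- back onto the tile.
      first : HasExactly 𝓑 q (λ s → Chamber b c s × s ≢ d)
      first = exactly-others 𝓑 (order bcd) bcd

      s : Fin q → Vertex
      s = proj₁ first

      bcs : ∀ j → Chamber b c (s j) × s j ≢ d
      bcs = proj₁ (proj₂ (proj₂ first))

      -- The edge `c (s j)` varies with `j`, but the number of choices on it is always `q`, so the
      -- pairs can be numbered by `remQuot`.
      second : ∀ j → HasExactly 𝓑 q (λ z → Chamber c (s j) z × z ≢ b)
      second j = exactly-others 𝓑 (order (chamber-rotate (proj₁ (bcs j)))) (chamber-rotate (proj₁ (bcs j)))

      z : Fin q → Fin q → Vertex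
      z j = proj₁ (second j)

      tile-crd : ∀ i {l} → l ∈𝔭 𝟘 → l ∈𝔭 crd i 0 0
      tile-crd Fin.zero           l∈ = l∈
      tile-crd (Fin.suc Fin.zero) l∈ = l∈

      prolonged : ∀ j k → _
      -- The sizes `0 0` mean that a single tile is prolonged: successors see only the terminal tile
      -- of `u`.
      prolonged j k = prolong-chart i θ 0 0 (s j) (z j k)
        (proj₁ (bcs j) , proj₂ (bcs j) , proj₁ (proj₂ (proj₂ (second j))) k)

      ψ : Fin q → Fin q → Chart
      ψ j k = proj₁ (prolonged j k)

      ψ≡θ : ∀ j k l → l ∈𝔭 crd i 0 0 → ⟦ ψ j k ⟧ (point l) ≡ ⟦ θ ⟧ (point l)
      ψ≡θ j k = proj₁ (proj₂ (prolonged j k))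

      ψs : ∀ j k → ⟦ ψ j k ⟧ (point (crd i 2 0)) ≡ s j
      ψs j k = proj₁ (proj₂ (proj₂ (prolonged j k)))

      ψz : ∀ j k → ⟦ ψ j k ⟧ (point (crd i 2 1)) ≡ z j k
      ψz j k = proj₂ (proj₂ (proj₂ (prolonged j k)))

      word : Fin q → Fin q → 𝔅 (e i)
      word j k = word-of (ψ j k)
        (prolong-rotating θ (ψ j k) (proj₁ (proj₂ (chart-of a))) (crd i 0 0) (ψ≡θ j k)) (e i)

      word-initial : ∀ j k → o (word j k) ∼ a
      word-initial j k = ε , λ l l∈ → trans (▷-identity _)
        (trans (ψ≡θ j k l (tile-crd i (recompute (∈𝔭? 𝟘 l) l∈))) (sym (a≡θ l l∈)))

      -- Both words start with the same tile, so the group element relating them fixes a vertex and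
      -- is trivial. Equal orbits therefore mean equal added vertices.
      word-injective : ∀ j k j′ k′ → word j k ∼ word j′ k′ → (j , k) ≡ (j′ , k′)
      word-injective j k j′ k′ (γ , h) = pair (proj₁ (proj₂ first) s≡s′) z≡z′
        where
        O∈ : (0 , 0) ∈𝔭 crd i 0 0
        O∈ = tile-crd i (ℕ.z≤n , ℕ.z≤n)
        trivial : ∀ x → γ ▷ x ≡ x
        trivial x = trans (free-agree free γ ε (trans (h (0 , 0) (ℕ.z≤n , ℕ.z≤n))
          (trans (ψ≡θ j′ k′ (0 , 0) O∈) (trans (sym (ψ≡θ j k (0 , 0) O∈)) (sym (▷-identity _))))) x) (▷-identity x)
        s≡s′ : s j ≡ s j′
        s≡s′ = trans (sym (trans (trivial _) (ψs j k)))
          (trans (h (crd i 2 0) (edge-∈ i ℕ.≤-refl ℕ.z≤n)) (ψs j′ k′))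
        z≡z′ : z j k ≡ z j′ k′
        z≡z′ = trans (sym (trans (trivial _) (ψz j k)))
          (trans (h (crd i 2 1) (edge-∈ i ℕ.≤-refl ℕ.≤-refl)) (ψz j′ k′))
        pair : j ≡ j′ → z j k ≡ z j′ k′ → (j , k) ≡ (j′ , k′)
        pair refl eq = cong (λ k → j , k) (proj₁ (proj₂ (second j)) eq)

      word-surjective : ∀ (w : 𝔅 (e i)) → o w ∼ a → ∃₂ λ j k → word j k ∼ w
      word-surjective w (γ , h) = found (exhaust (Step-cong
          (shared 1 0 ℕ.≤-refl ℕ.z≤n (edge-∈ i (ℕ.s≤s ℕ.z≤n) ℕ.z≤n))
          (shared 1 1 ℕ.≤-refl ℕ.≤-refl (edge-∈ i (ℕ.s≤s ℕ.z≤n) ℕ.≤-refl))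
          (shared 0 1 ℕ.z≤n ℕ.≤-refl (edge-∈ i ℕ.z≤n ℕ.≤-refl)) refl refl
          (Step-▷ γ (word-step i w))))
        where
        shared : ∀ k l → k ℕ.≤ 1 → l ℕ.≤ 1 → .(kl∈ : crd i k l ∈𝔭 e i) → γ ▷ at w (crd i k l) kl∈ ≡ corner k l
        shared k l p q _ = trans (h (crd i k l) (tile-∈ i p q)) (a≡θ (crd i k l) (tile-∈ i p q))
        s′ = γ ▷ at w (crd i 2 0) (edge-∈ i ℕ.≤-refl ℕ.z≤n)
        z′ = γ ▷ at w (crd i 2 1) (edge-∈ i ℕ.≤-refl ℕ.≤-refl)
        exhaust : Step b c d s′ z′ → ∃₂ λ j k → s j ≡ s′ × z j k ≡ z′
        exhaust (c₁ , s≢ , c₂ , z≢) =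
          let j , sj≡ = proj₂ (proj₂ (proj₂ first)) s′ (c₁ , s≢)
              k , zk≡ = proj₂ (proj₂ (proj₂ (second j))) z′ (subst (λ s → Chamber c s z′) (sym sj≡) c₂ , z≢)
          in j , k , sj≡ , zk≡
        found : (∃₂ λ j k → s j ≡ s′ × z j k ≡ z′) → ∃₂ λ j k → word j k ∼ w
        found (j , k , sj≡ , zk≡) = j , k , Setoid.sym (W (e i)) {w} {word j k}
            (γ , λ l l∈ → cases l l∈ (edge-cover i l (recompute (∈𝔭? (e i) l) l∈)))
          where
          cases : ∀ l .(l∈ : l ∈𝔭 e i) → l ∈𝔭 𝟘 ⊎ (l ≡ crd i 2 0 ⊎ l ≡ crd i 2 1) →
                  γ ▷ at w l l∈ ≡ ⟦ ψ j k ⟧ (point l)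
          cases l l∈ (inj₁ l∈𝟘) = trans (h l l∈𝟘) (trans (a≡θ l l∈𝟘) (sym (ψ≡θ j k l (tile-crd i l∈𝟘))))
          cases l l∈ (inj₂ (inj₁ refl)) = trans (sym sj≡) (sym (ψs j k))
          cases l l∈ (inj₂ (inj₂ refl)) = trans (sym zk≡) (sym (ψz j k))

    enumeration : Bijection (setoid (Fin (q ℕ.* q))) (Successor u i)
    enumeration = record
      { to        = λ n → let j , k = remQuot q n in word j k , word-initial j k
      ; cong      = λ { {n} refl → let j , k = remQuot q n in Setoid.refl (W (e i)) {word j k} }
      ; bijective =
          (λ {n} {n′} eq → let j , k = remQuot q n ; j′ , k′ = remQuot q n′ in
             trans (sym (combine-remQuot {q} q n))
               (trans (cong (λ p → combine (proj₁ p) (proj₂ p)) (word-injective j k j′ k′ eq)) (combine-remQuot {q} q n′)))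
        , λ { (w , ow∼tu) → let j , k , eq = word-surjective w ow∼tu in combine j k ,
              λ { refl → subst (λ p → word (proj₁ p) (proj₂ p) ∼ w) (sym (remQuot-combine j k)) eq } }
      }

-- Sums in ℝ₊

≃-reflexive : ∀ {x y : ℝ} → (∀ n → seq x n ≡ seq y n) → x ≃ y
≃-reflexive {x} {y} eq ε ε>0 = 0 , λ n _ →
  subst (λ d → ℚ.∣ d ∣ ℚ.≤ ε) (trans (sym (ℚ.+-inverseʳ (seq y n))) (cong (ℚ._- seq y n) (sym (eq n)))) (ℚ.<⇒≤ ε>0)

+₊-cong : ∀ {x x′ y y′ : ℝ₊} → value x ≃ value x′ → value y ≃ value y′ → value (x +₊ y) ≃ value (x′ +₊ y′)
+₊-cong {x} {x′} {y} {y′} p r ε ε>0 =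
  let N , h = p δ δ>0
      N′ , h′ = r δ δ>0
  in N ℕ.⊔ N′ , λ n le → subst₂ (λ d ε → ℚ.∣ d ∣ ℚ.≤ ε)
       (regroup (seq (value x) n) (seq (value x′) n) (seq (value y) n) (seq (value y′) n)) δ+δ≡ε
       (ℚ.≤-trans (ℚ.∣p+q∣≤∣p∣+∣q∣ (seq (value x) n ℚ.- seq (value x′) n) (seq (value y) n ℚ.- seq (value y′) n))
         (ℚ.+-mono-≤ (h n (ℕ.m⊔n≤o⇒m≤o N N′ le)) (h′ n (ℕ.m⊔n≤o⇒n≤o N N′ le))))
  where
  open +-*-Solver using (solve; _:=_; _:+_; _:-_)
  δ = ½ ℚ.* ε
  δ>0 : 0ℚ ℚ.< δ
  δ>0 = ℚ.positive⁻¹ δ {{ℚ.pos*pos⇒pos ½ ε {{ℚ.positive ε>0}}}}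
  δ+δ≡ε : δ ℚ.+ δ ≡ ε
  δ+δ≡ε = trans (sym (ℚ.*-distribʳ-+ ε ½ ½)) (ℚ.*-identityˡ ε)
  regroup : ∀ a a′ b b′ → (a ℚ.- a′) ℚ.+ (b ℚ.- b′) ≡ (a ℚ.+ b) ℚ.- (a′ ℚ.+ b′)
  regroup = solve 4 (λ a a′ b b′ → (a :- a′) :+ (b :- b′) := (a :+ b) :- (a′ :+ b′)) refl

∑ : ∀ {n} → (Fin n → ℝ₊) → ℝ₊
∑ = Vector.foldr _+₊_ 0ℝ₊

∑-cong : ∀ {n} (x y : Fin n → ℝ₊) → (∀ k → value (x k) ≃ value (y k)) → value (∑ x) ≃ value (∑ y)
∑-cong {zero}  x y eq = ≃-reflexive {value 0ℝ₊} {value 0ℝ₊} (λ _ → refl)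
∑-cong {suc n} x y eq = +₊-cong {x Fin.zero} {y Fin.zero} {∑ (x ∘ Fin.suc)} {∑ (y ∘ Fin.suc)}
  (eq Fin.zero) (∑-cong (x ∘ Fin.suc) (y ∘ Fin.suc) (eq ∘ Fin.suc))

-- Rationals are stored in lowest terms, so the equation is checked on unnormalised fractions, where
-- it computes.
suc/1 : ∀ n → + suc n ℚ./ 1 ≡ 1ℚ ℚ.+ + n ℚ./ 1
suc/1 n = ℚ.toℚᵘ-injective (ℚᵘ.≃-trans (ℚ.toℚᵘ-fromℚᵘ (mkℚᵘ (+ suc n) 0))
  (ℚᵘ.≃-sym (ℚᵘ.≃-trans (ℚ.toℚᵘ-homo-+ 1ℚ (+ n ℚ./ 1))
    (ℚᵘ.≃-trans (ℚᵘ.+-cong (ℚᵘ.≃-refl {mkℚᵘ (+ 1) 0}) (ℚ.toℚᵘ-fromℚᵘ (mkℚᵘ (+ n) 0)))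
      (*≡* (cong (_* + 1) (cong (λ x → + 1 + x) (ℤ.*-identityʳ (+ n)))))))))

∑-constant : ∀ n (x : ℝ₊) j → seq (value (∑ {n} (λ _ → x))) j ≡ + n ℚ./ 1 ℚ.* seq (value x) j
∑-constant zero    x j = sym (ℚ.*-zeroˡ (seq (value x) j))
∑-constant (suc n) x j = trans (cong (seq (value x) j ℚ.+_) (∑-constant n x j))
  (trans (cong (ℚ._+ (+ n ℚ./ 1 ℚ.* seq (value x) j)) (sym (ℚ.*-identityˡ (seq (value x) j))))
  (trans (sym (ℚ.*-distribʳ-+ (seq (value x) j) 1ℚ (+ n ℚ./ 1)))
    (cong (ℚ._* seq (value x) j) (sym (suc/1 n)))))

cancel-/ : ∀ n d e .{{_ : NonZero d}} .{{_ : NonZero e}} → e ≡ n ℕ.* d →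
           (+ n ℚ./ 1) ℚ.* (+ 1 ℚ./ e) ≡ + 1 ℚ./ d
cancel-/ n (suc d) (suc e) e≡nd = ℚ.toℚᵘ-injective
  (ℚᵘ.≃-trans (ℚ.toℚᵘ-homo-* (+ n ℚ./ 1) (+ 1 ℚ./ suc e))
  (ℚᵘ.≃-trans (ℚᵘ.*-cong (ℚ.toℚᵘ-fromℚᵘ (mkℚᵘ (+ n) 0)) (ℚ.toℚᵘ-fromℚᵘ (mkℚᵘ (+ 1) e)))
  (ℚᵘ.≃-trans (*≡* cross) (ℚᵘ.≃-sym (ℚ.toℚᵘ-fromℚᵘ (mkℚᵘ (+ 1) d))))))
  where
  -- `suc (e ℕ.+ 0)` is what the denominator `1 * suc e` of the product reduces to.
  cross : (+ n * + 1) * + suc d ≡ + 1 * + suc (e ℕ.+ 0)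
  cross = trans (cong (_* + suc d) (ℤ.*-identityʳ (+ n)))
    (trans (sym (ℤ.pos-* n (suc d)))
    (trans (cong +_ (trans (sym e≡nd) (cong suc (sym (ℕ.+-identityʳ e))))) (sym (ℤ.*-identityˡ (+ suc (e ℕ.+ 0))))))

q²-cancel : ∀ q .{{_ : NonZero q}} k → (+ (q ℕ.* q) ℚ./ 1) ℚ.* q ^- (2 ℕ.+ k) ≡ q ^- k
q²-cancel q k = cancel-/ (q ℕ.* q) (q ℕ.^ k) (q ℕ.^ (2 ℕ.+ k)) {{ℕ.m^n≢0 q k}} {{ℕ.m^n≢0 q (2 ℕ.+ k)}}
  (sym (ℕ.*-assoc q q (q ℕ.^ k)))

size : Shape → ℕ
size (m₁ , m₂) = m₁ ℕ.+ m₂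

size-⊕-e : ∀ i m → 2 ℕ.* size (m ⊕ e i) ≡ 2 ℕ.+ 2 ℕ.* size m
size-⊕-e i m@(m₁ , m₂) = trans (cong (2 ℕ.*_) (size-suc i)) (ℕ.*-distribˡ-+ 2 1 (size m))
  where
  size-suc : ∀ i → size (m ⊕ e i) ≡ suc (size m)
  size-suc Fin.zero           = cong₂ ℕ._+_ (ℕ.+-comm m₁ 1) (ℕ.+-identityʳ m₂)
  size-suc (Fin.suc Fin.zero) = trans (cong₂ ℕ._+_ (ℕ.+-identityʳ m₁) (ℕ.+-comm m₂ 1)) (ℕ.+-suc m₁ m₂)

-- The values of `f` need only agree up to `≃`, since they may come from different representatives
-- of an orbit. Once each is replaced by `x`, the sum is computed exactly, term by term in the
-- sequences.
constant-isSum : ∀ (S : Setoid 0ℓ 0ℓ) (f : Setoid.Carrier S → ℝ₊) {n} → Bijection (setoid (Fin n)) S →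
  ∀ x → (∀ w → value (f w) ≃ value x) → ∀ total → (∀ j → seq (value total) j ≡ + n ℚ./ 1 ℚ.* seq (value x) j) →
  IsSum S f total
constant-isSum S f {n} enum x f≃x total total≡ = n , enum ,
  Setoid.sym ℝ₊-setoid {∑ (f ∘ Bijection.to enum)} {total}
    (Setoid.trans ℝ₊-setoid {∑ (f ∘ Bijection.to enum)} {∑ {n} (λ _ → x)} {total}
      (∑-cong (f ∘ Bijection.to enum) (λ _ → x) (f≃x ∘ Bijection.to enum))
      (≃-reflexive {value (∑ {n} (λ _ → x))} {value total} (λ j → trans (∑-constant n x j) (sym (total≡ j)))))

-- The averaging identity

module Harmonic (𝓑 : Building) (q : ℕ) .{{nz : NonZero q}} (order : OfOrder 𝓑 q)
  {Γ : Group 0ℓ 0ℓ} (action : TypeRotatingAction 𝓑 Γ) (free : TypeRotatingAction.FreeOnVertices action) where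
  open Words 𝓑 action
  open Products 𝓑 action free
  open Successors 𝓑 action free order

  -- `extend` with the shape and the initial tile decoupled: the summand at a product has the larger
  -- shape but the initial tile of `u`.
  weighted : Func A ℝ₊-setoid → Shape → 𝔅 𝟘 → ℝ₊
  weighted g m a = _·_ (q ^- (2 ℕ.* size m)) {{^--nonNegative q (2 ℕ.* size m)}} (Func.to g a)

  extend-cong : (g : Func A ℝ₊-setoid) → ∀ {m m′} (p : 𝔅 m′) (u : 𝔅 m) → o p ∼ o u →
    value (Func.to (extend q {{nz}} g m′) p) ≃ value (weighted g m′ (o u))
  extend-cong g {m′ = m′} p u op∼ou = ·-cong (q ^- (2 ℕ.* size m′)) {{^--nonNegative q (2 ℕ.* size m′)}}
    {Func.to g (o p)} {Func.to g (o u)} (Func.cong g op∼ou)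

  -- There are q² products, and each has weight q⁻² times that of u.
  extend-scale : (g : Func A ℝ₊-setoid) → ∀ i m (u : 𝔅 m) j →
    seq (value (Func.to (extend q {{nz}} g m) u)) j ≡
    + (q ℕ.* q) ℚ./ 1 ℚ.* seq (value (weighted g (m ⊕ e i) (o u))) j
  extend-scale g i m u j = go (2 ℕ.* size m) (2 ℕ.* size (m ⊕ e i)) (size-⊕-e i m) (seq (value (Func.to g (o u))) j)
    where
    go : ∀ k k′ → k′ ≡ 2 ℕ.+ k → ∀ x → q ^- k ℚ.* x ≡ + (q ℕ.* q) ℚ./ 1 ℚ.* (q ^- k′ ℚ.* x)
    go k _ refl x = trans (cong (ℚ._* x) (sym (q²-cancel q k)))
      (ℚ.*-assoc (+ (q ℕ.* q) ℚ./ 1) (q ^- (2 ℕ.+ k)) x)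

  origin-cong : ∀ {m} (u v : 𝔅 m) → u ∼ v → o u ∼ o v
  origin-cong {m} u v (γ , h) = γ , λ l l∈ → h l (initial-∈ l l∈)
    where
    initial-∈ : ∀ l → l ∈𝔭 𝟘 → l ∈𝔭 m
    initial-∈ l (p , q) = ℕ.≤-trans p (ℕ.s≤s ℕ.z≤n) , ℕ.≤-trans q (ℕ.s≤s ℕ.z≤n)

  product-origin : ∀ {m i} (u : 𝔅 m) (w : 𝔅 (e i)) (v : 𝔅 (m ⊕ e i)) → IsProduct {m} {i} u w v → o v ∼ o u
  product-origin {m} {i} u w v (p , p∼v , p∼u , _) = Setoid.trans A {o v} {o p} {o u}
    (Setoid.sym A {o p} {o v} (origin-cong p v p∼v))
    (origin-cong (window 𝟘 m (ℕ.m≤m+n (proj₁ m) (proj₁ (e i)) , ℕ.m≤m+n (proj₂ m) (proj₂ (e i))) p) u p∼u)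

  products-isSum : ∀ g i m (u : 𝔅 m)
    (product : (w : Setoid.Carrier (Successor u i)) → ∃! _∼_ (IsProduct {m} {i} u (proj₁ w))) →
    IsSum (Successor u i) (λ w → Func.to (extend q {{nz}} g (m ⊕ e i)) (proj₁ (product w))) (Func.to (extend q {{nz}} g m) u)
  products-isSum g i m u product = constant-isSum (Successor u i)
    (λ w → Func.to (extend q {{nz}} g (m ⊕ e i)) (proj₁ (product w)))
    (enumeration i u) (weighted g (m ⊕ e i) (o u))
    (λ w → extend-cong g {m} {m ⊕ e i} (proj₁ (product w)) u
             (product-origin {m} {i} u (proj₁ w) (proj₁ (product w)) (proj₁ (proj₂ (product w)))))
    (Func.to (extend q {{nz}} g m) u) (extend-scale g i m u)

  products : ∀ i m (u : 𝔅 m) (w : Setoid.Carrier (Successor u i)) → ∃! _∼_ (IsProduct {m} {i} u (proj₁ w))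
  products i m u = along (crd-coordinates i m) u
    where
    along : ∀ {m} → (∃₂ λ M N → m ≡ crd i M N) → (u : 𝔅 m) (w : Setoid.Carrier (Successor u i)) →
            ∃! _∼_ (IsProduct {m} {i} u (proj₁ w))
    along (M , N , refl) u (w , ow∼tu) = product i M N u w ow∼tu

proposition4p1 : (𝓑 : Building) (q : ℕ) .{{_ : NonZero q}} →
    LocallyFinite 𝓑 → Thick 𝓑 → OfOrder 𝓑 q →
    (Γ : Group 0ℓ 0ℓ) (action : TypeRotatingAction 𝓑 Γ) →
    TypeRotatingAction.FreeOnVertices action →
    TypeRotatingAction.FinitelyManyVertexOrbits action →
    let open Words 𝓑 action in
    (g : Func A ℝ₊-setoid) →
    (i : Fin 2) (m : Shape) (u : 𝔅 m) →
    Σ[ product ∈ ((w : Setoid.Carrier (Successor u i)) → ∃! _∼_ (IsProduct {m} {i} u (proj₁ w))) ]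
    IsSum (Successor u i)
    (λ w → Func.to (extend q g (m ⊕ e i)) (proj₁ (product w)))
    (Func.to (extend q g m) u)
proposition4p1 𝓑 q {{nz}} _ _ order _ action free _ g i m u =
  products i m u , products-isSum g i m u (products i m u)
  where open Harmonic 𝓑 q {{nz}} order action free
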